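{- For every positive integer $n \geq 9$, $A_n=\{ k \in \mathbb{N} \mid k \geq n \}$. Equivalently, for all positive integers $m \geq n \geq 9$ there exist positive rational numbers $a_1,\dots,a_n$ with $a_1 a_2\cdots a_n = 1$ and $a_1+a_2+\cdots+a_n = m$, and conversely every positive integer that is the sum of $n$ positive rationals with product $1$ is at least $n$.
   Context: Here $\mathbb{N}$ denotes the set of positive integers, and for $n \in \mathbb{N}$, $A_n = \{ s \in \mathbb{N} \mid \exists a_1,\dots,a_n \in \mathbb{Q}_{>0} \text{ with } \prod_{i=1}^n a_i = 1 \text{ and } \sum_{i=1}^n a_i = s \}$, where $\mathbb{Q}_{>0}$ is the set of positive rational numbers. -}

module Defs where

open import Data.Nat using (ℕ)
open import Data.Fin using (Fin)
open import Data.Product using (Σ; _×_)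
open import Data.Rational using (ℚ; 0ℚ; 1ℚ; _+_; _*_; _<_)
open import Data.Integer using (+_)
import Data.Rational as ℚ
open import Data.Vec.Functional using (foldr)
open import Relation.Binary.PropositionalEquality using (_≡_)

sumℚ : ∀ {n} → (Fin n → ℚ) → ℚ
sumℚ a = foldr _+_ 0ℚ a

prodℚ : ∀ {n} → (Fin n → ℚ) → ℚ
prodℚ a = foldr _*_ 1ℚ a

ℕ→ℚ : ℕ → ℚ
ℕ→ℚ s = (+ s) ℚ./ 1

InA : ℕ → ℕ → Set
InA n s = Σ (Fin n → ℚ) λ a → ((i : Fin n) → 0ℚ < a i) × (prodℚ a ≡ 1ℚ) × (sumℚ a ≡ ℕ→ℚ s)

{-# OPTIONS --safe #-}
module Submission where

-- The bound n ≤ s is AM-GM. For existence, appending a 1 reduces everything to n = 9, and there one adds up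
-- three triples: for rational v and c the numbers (2 , v² - v + 1 , v² + v + 1) = (a , b , w) satisfy
-- a³ + b³ + w³ = (v² + 5) a b w, so c b² / (a w), c w² / (a b), c a² / (b w) have sum c (v² + 5) and product c³.
-- With c = 16/9, 9/16, 1 the equation for the sum s becomes "144 s - 2405 is a sum of three odd squares", which
-- is Gauss's theorem on three triangular numbers, since 144 s - 2405 ≡ 3 (mod 8).
-- This covers s ≥ 17; below that, triples with c = 1 and v = 0, 1, or the numbers (2 , 2 , 1/2 , 1/2), and ones do.
--
-- Gauss's theorem is proved by comparing two counting functions of m (even):
--   #F m = #{(a , b , c) integers : a² + a + b² + b + c² + c = m},
--   #H m = #{(x , y , z) nonnegative integers : xy + yz + zx + x + y + z = m}.
-- Both satisfy Σⱼ (m - 4 (j² + j)) #(m - j² - j) = 0, the sum being over all integers j. This recurrence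
-- determines # up to a factor, so #F and #H are proportional, and (0 , 0 , m) shows that #H m > 0.
-- For #F the recurrence holds because the four variables of a² + a + b² + b + c² + c + j² + j = m play the
-- same role. For #H, symmetrising over rotations of (x , y , z) reduces it to Σ p q = 0 over the
-- solutions of xy + yz + zx + x + y + z + j² + j = m, where p = x - j and q = y + j + 1; this follows from
-- an explicit matching of the solutions with p q > 0 and those with p q < 0.

open import Defs
open import Data.Bool using (true; false; if_then_else_)
open import Data.Empty using (⊥-elim)
open import Data.Fin using (Fin; zero; suc)
import Data.Integer as ℤ
import Data.Integer.Properties as ℤ
open import Data.List using (List; []; _∷_; map; filter; cartesianProduct; upTo; _++_)
open import Data.List.Membership.Propositional using (_∈_)
open import Data.List.Membership.Propositional.Properties
  using (∈-map⁺; ∈-map⁻; ∈-filter⁺; ∈-filter⁻; ∈-cartesianProduct⁺; ∈-upTo⁺)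
open import Data.List.Membership.Propositional.Properties.WithK using (unique∧set⇒bag)
open import Data.List.Relation.Binary.BagAndSetEquality using (∼bag⇒↭)
open import Data.List.Relation.Binary.Permutation.Propositional as ↭ using (_↭_)
open import Data.List.Relation.Unary.Any using (here; there)
open import Data.List.Relation.Unary.Unique.Propositional using (Unique)
import Data.List.Relation.Unary.Unique.Propositional.Properties as Unique
open import Data.Nat using (ℕ; zero; suc)
import Data.Nat as ℕ
import Data.Nat.Properties as ℕ
open import Data.Nat.Induction using (<-rec)
open import Data.Product using (Σ; ∃; _×_; _,_; proj₁; proj₂)
import Data.Rational.Unnormalised as ℚᵘ
import Data.Rational.Unnormalised.Properties as ℚᵘ
open import Data.Sum using (_⊎_; inj₁; inj₂)
import Data.Vec.Functional as Vec
open import Function using (_∘_)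
open import Function.Bundles using (_⇔_; mk⇔)
open import Level using (0ℓ)
open import Relation.Binary.PropositionalEquality
  using (_≡_; refl; sym; trans; cong; cong₂; subst; subst₂; module ≡-Reasoning)
open import Relation.Nullary using (¬_; Dec; yes; no; does)
open import Relation.Nullary.Decidable using (_×-dec_; ¬?)
open import Relation.Unary using (Pred; Decidable)

-- Gauss's theorem on three triangular numbers.

module ThreeTriangular where

  open import Data.Integer using (ℤ; +_; -[1+_]; 0ℤ; 1ℤ; _+_; _*_; _-_; -_; _≤_; ∣_∣; +≤+)
  open import Data.Integer.Tactic.RingSolver using (solve-∀)

  variable
    A B : Set

  -- Finite sums, indicators and counting.

  ∑ : List A → (A → ℤ) → ℤ
  ∑ []       f = 0ℤ
  ∑ (x ∷ xs) f = f x + ∑ xs f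

  ∑-cong : ∀ (xs : List A) {f g} → (∀ x → f x ≡ g x) → ∑ xs f ≡ ∑ xs g
  ∑-cong []       e = refl
  ∑-cong (x ∷ xs) e = cong₂ _+_ (e x) (∑-cong xs e)

  ∑-0 : ∀ (xs : List A) → ∑ xs (λ _ → 0ℤ) ≡ 0ℤ
  ∑-0 []       = refl
  ∑-0 (x ∷ xs) = trans (ℤ.+-identityˡ _) (∑-0 xs)

  ∑-+ : ∀ (xs : List A) f g → ∑ xs (λ x → f x + g x) ≡ ∑ xs f + ∑ xs g
  ∑-+ []       f g = refl
  ∑-+ (x ∷ xs) f g = trans (cong (λ s → f x + g x + s) (∑-+ xs f g)) (interchange (f x) (g x) (∑ xs f) (∑ xs g))
    where
    interchange : ∀ a b c d → a + b + (c + d) ≡ a + c + (b + d)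
    interchange = solve-∀

  ∑-*ʳ : ∀ (xs : List A) f c → ∑ xs (λ x → f x * c) ≡ ∑ xs f * c
  ∑-*ʳ []       f c = refl
  ∑-*ʳ (x ∷ xs) f c = trans (cong (λ s → f x * c + s) (∑-*ʳ xs f c)) (sym (ℤ.*-distribʳ-+ c (f x) (∑ xs f)))

  ∑-++ : ∀ (xs ys : List A) f → ∑ (xs ++ ys) f ≡ ∑ xs f + ∑ ys f
  ∑-++ []       ys f = sym (ℤ.+-identityˡ _)
  ∑-++ (x ∷ xs) ys f = trans (cong (λ s → f x + s) (∑-++ xs ys f)) (sym (ℤ.+-assoc (f x) _ _))

  ∑-map : ∀ (φ : A → B) xs f → ∑ (map φ xs) f ≡ ∑ xs (f ∘ φ)
  ∑-map φ []       f = refl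
  ∑-map φ (x ∷ xs) f = cong (λ s → f (φ x) + s) (∑-map φ xs f)

  ∑-cartesianProduct : ∀ (xs : List A) (ys : List B) f →
    ∑ (cartesianProduct xs ys) f ≡ ∑ xs (λ x → ∑ ys (λ y → f (x , y)))
  ∑-cartesianProduct []       ys f = refl
  ∑-cartesianProduct (x ∷ xs) ys f =
    trans (∑-++ (map (x ,_) ys) _ f) (cong₂ _+_ (∑-map (x ,_) ys f) (∑-cartesianProduct xs ys f))

  ∑-↭ : ∀ {xs ys : List A} f → xs ↭ ys → ∑ xs f ≡ ∑ ys f
  ∑-↭ f ↭.refl         = refl
  ∑-↭ f (↭.prep x p)   = cong (λ s → f x + s) (∑-↭ f p)
  ∑-↭ f (↭.swap x y p) = trans (cong (λ s → f x + (f y + s)) (∑-↭ f p)) (exchange (f x) (f y) _)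
    where
    exchange : ∀ a b c → a + (b + c) ≡ b + (a + c)
    exchange = solve-∀
  ∑-↭ f (↭.trans p q)  = trans (∑-↭ f p) (∑-↭ f q)

  -- The indicator of `P` times `n`. It lets sums over different solution sets run over one fixed
  -- list, so that splitting a set into regions becomes a termwise identity.
  gate : {P : Set} → Dec P → ℤ → ℤ
  gate P? n = if does P? then n else 0ℤ

  ∑-filter : ∀ {P : Pred A 0ℓ} (P? : Decidable P) xs f → ∑ (filter P? xs) f ≡ ∑ xs (λ x → gate (P? x) (f x))
  ∑-filter P? []       f = refl
  ∑-filter P? (x ∷ xs) f with does (P? x)
  ... | true  = cong (λ s → f x + s) (∑-filter P? xs f)
  ... | false = trans (∑-filter P? xs f) (sym (ℤ.+-identityˡ _))

  gate-split : ∀ {P Q : Set} (P? : Dec P) (Q? : Dec Q) n →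
    gate P? n ≡ gate (P? ×-dec Q?) n + gate (P? ×-dec ¬? Q?) n
  gate-split (no  _) Q?      n = refl
  gate-split (yes _) (yes _) n = sym (ℤ.+-identityʳ n)
  gate-split (yes _) (no  _) n = sym (ℤ.+-identityˡ n)

  gate-zero : ∀ {P : Set} (P? : Dec P) {n} → (P → n ≡ 0ℤ) → gate P? n ≡ 0ℤ
  gate-zero (yes p) e = e p
  gate-zero (no  _) e = refl

  gate-cong : ∀ {P : Set} (P? : Dec P) {m n} → (P → m ≡ n) → gate P? m ≡ gate P? n
  gate-cong (yes p) e = e p
  gate-cong (no  _) e = refl

  gate-* : ∀ {P : Set} (P? : Dec P) n → gate P? n ≡ gate P? 1ℤ * n
  gate-* (yes _) n = sym (ℤ.*-identityˡ n)
  gate-* (no  _) n = refl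

  gate-*ʳ : ∀ {P : Set} (P? : Dec P) n c → gate P? (n * c) ≡ gate P? n * c
  gate-*ʳ (yes _) n c = refl
  gate-*ʳ (no  _) n c = refl

  gate-+ : ∀ {P : Set} (P? : Dec P) m n → gate P? (m + n) ≡ gate P? m + gate P? n
  gate-+ (yes _) m n = refl
  gate-+ (no  _) m n = refl

  module _ {P : Pred A 0ℓ} (P? : Decidable P) where

    count : List A → ℤ
    count xs = ∑ xs (λ x → gate (P? x) 1ℤ)

    count-nonneg : ∀ xs → 0ℤ ≤ count xs
    count-nonneg []       = ℤ.≤-refl
    count-nonneg (x ∷ xs) with does (P? x)
    ... | true  = ℤ.+-mono-≤ (+≤+ (ℕ.z≤n {1})) (count-nonneg xs)
    ... | false = ℤ.+-mono-≤ (ℤ.≤-refl {0ℤ}) (count-nonneg xs)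

    count-pos : ∀ {x xs} → x ∈ xs → P x → 1ℤ ≤ count xs
    count-pos {x} {_ ∷ xs} (here refl) px with P? x
    ... | yes _  = ℤ.+-mono-≤ (ℤ.≤-refl {1ℤ}) (count-nonneg xs)
    ... | no ¬px = ⊥-elim (¬px px)
    count-pos {x} {y ∷ xs} (there x∈) px with does (P? y)
    ... | true  = ℤ.+-mono-≤ (+≤+ (ℕ.z≤n {1})) (count-pos x∈ px)
    ... | false = ℤ.+-mono-≤ (ℤ.≤-refl {0ℤ}) (count-pos x∈ px)

    count-zero : ∀ xs → (∀ x → ¬ P x) → count xs ≡ 0ℤ
    count-zero xs ¬p = trans (∑-cong xs (λ x → gate-zero (P? x) (⊥-elim ∘ ¬p x))) (∑-0 xs)

    count-witness : ∀ xs → 1ℤ ≤ count xs → ∃ P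
    count-witness []       (+≤+ ())
    count-witness (x ∷ xs) h with P? x
    ... | yes px = x , px
    ... | no  _  = count-witness xs (subst (1ℤ ≤_) (ℤ.+-identityˡ _) h)

  -- The image under `φ` of the filtered first list and the filtered second list are both free of
  -- repetitions and have the same members, hence are permutations of each other.
  ∑-bijection : ∀ {xs : List A} {ys : List B} → Unique xs → Unique ys →
    {P : Pred A 0ℓ} {Q : Pred B 0ℓ} (P? : Decidable P) (Q? : Decidable Q) →
    (∀ {x} → P x → x ∈ xs) → (∀ {y} → Q y → y ∈ ys) →
    (φ : A → B) (ψ : B → A) → (∀ x → ψ (φ x) ≡ x) → (∀ y → φ (ψ y) ≡ y) →
    (∀ {x} → P x → Q (φ x)) → (∀ {y} → Q y → P (ψ y)) →
    (f : B → ℤ) →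
    ∑ xs (λ x → gate (P? x) (f (φ x))) ≡ ∑ ys (λ y → gate (Q? y) (f y))
  ∑-bijection {xs = xs} {ys} uxs uys {P} {Q} P? Q? P⊆ Q⊆ φ ψ ψφ φψ PQ QP f = begin
    ∑ xs (λ x → gate (P? x) (f (φ x))) ≡⟨ ∑-filter P? xs (f ∘ φ) ⟨
    ∑ (filter P? xs) (f ∘ φ)           ≡⟨ ∑-map φ (filter P? xs) f ⟨
    ∑ (map φ (filter P? xs)) f         ≡⟨ ∑-↭ f image↭ ⟩
    ∑ (filter Q? ys) f                 ≡⟨ ∑-filter Q? ys f ⟩
    ∑ ys (λ y → gate (Q? y) (f y))     ∎
    where
    open ≡-Reasoning
    φ-injective : ∀ {x x′} → φ x ≡ φ x′ → x ≡ x′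
    φ-injective e = trans (sym (ψφ _)) (trans (cong ψ e) (ψφ _))
    to : ∀ {y} → y ∈ map φ (filter P? xs) → y ∈ filter Q? ys
    to y∈ with x , x∈ , refl ← ∈-map⁻ φ y∈ =
      let Qφx = PQ (proj₂ (∈-filter⁻ P? {xs = xs} x∈)) in ∈-filter⁺ Q? (Q⊆ Qφx) Qφx
    from : ∀ {y} → y ∈ filter Q? ys → y ∈ map φ (filter P? xs)
    from {y} y∈ =
      let Pψy = QP (proj₂ (∈-filter⁻ Q? {xs = ys} y∈))
      in subst (_∈ map φ (filter P? xs)) (φψ y) (∈-map⁺ φ (∈-filter⁺ P? (P⊆ Pψy) Pψy))
    image↭ : map φ (filter P? xs) ↭ filter Q? ys
    image↭ = ∼bag⇒↭ (unique∧set⇒bag (Unique.map⁺ φ-injective (Unique.filter⁺ P? uxs))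
                                     (Unique.filter⁺ Q? uys) (mk⇔ to from))

  -- All inequalities are kept in the form 0 ≤ e, so that a linear consequence is a sum of hypotheses
  -- followed by a ring identity.
  infixl 6 _⊕_
  infixl 7 _⊗_
  infix 5 _via_

  _⊕_ : ∀ {a b} → 0ℤ ≤ a → 0ℤ ≤ b → 0ℤ ≤ a + b
  _⊕_ = ℤ.+-mono-≤

  _⊗_ : ∀ {a b} → 0ℤ ≤ a → 0ℤ ≤ b → 0ℤ ≤ a * b
  _⊗_ {+ a} {+ b} _ _ = subst (0ℤ ≤_) (ℤ.pos-* a b) (+≤+ ℕ.z≤n)

  _via_ : ∀ {a b} → 0ℤ ≤ a → a ≡ b → 0ℤ ≤ b
  h via refl = h

  +≥0 : ∀ n → 0ℤ ≤ + n
  +≥0 n = +≤+ ℕ.z≤n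

  -- By integrality the negation of an inequality again has the form 0 ≤ e; `≱0⁻` is the way back.
  ≱0 : ∀ {a} → ¬ 0ℤ ≤ a → 0ℤ ≤ - a - 1ℤ
  ≱0 {+ n}      h = ⊥-elim (h (+≥0 n))
  ≱0 { -[1+ n ]} h = +≥0 n

  square-nonneg : ∀ j → 0ℤ ≤ j * j
  square-nonneg (+ n)    = +≥0 n ⊗ +≥0 n
  square-nonneg -[1+ n ] = +≥0 _

  -- Pronic numbers and the solution sets.

  pronic : ℤ → ℤ
  pronic j = j * j + j

  triangle : ℕ → ℕ
  triangle zero    = 0
  triangle (suc n) = suc n ℕ.+ triangle n

  pronic-pos : ∀ n → pronic (+ n) ≡ + (triangle n ℕ.+ triangle n)
  pronic-pos zero    = refl
  pronic-pos (suc n) = trans (step (+ n)) (trans (cong (λ s → s + ((1ℤ + + n) + (1ℤ + + n))) (pronic-pos n))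
    (rearrange (+ triangle n) (+ n)))
    where
    step : ∀ k → (1ℤ + k) * (1ℤ + k) + (1ℤ + k) ≡ k * k + k + ((1ℤ + k) + (1ℤ + k))
    step = solve-∀
    rearrange : ∀ t k → t + t + ((1ℤ + k) + (1ℤ + k)) ≡ (1ℤ + k + t) + (1ℤ + k + t)
    rearrange = solve-∀

  -- The reflection j ↦ -1 - j preserves j² + j and exchanges `+ n` with `-[1+ n ]`, so both receive
  -- the same index.
  index : ℤ → ℕ
  index (+ n)    = n
  index -[1+ n ] = n

  pronic≡ : ∀ j → pronic j ≡ + (triangle (index j) ℕ.+ triangle (index j))
  pronic≡ (+ n)    = pronic-pos n
  pronic≡ -[1+ n ] = trans (reflect (+ n)) (pronic-pos n)
    where
    reflect : ∀ k → (- (1ℤ + k)) * (- (1ℤ + k)) + (- (1ℤ + k)) ≡ k * k + k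
    reflect = solve-∀

  pronic-nonneg : ∀ j → 0ℤ ≤ pronic j
  pronic-nonneg j = +≥0 _ via sym (pronic≡ j)

  V₃ V : Set
  V₃ = ℤ × ℤ × ℤ
  V  = ℤ × V₃

  -- In terms of X = 2x + 1, Y = 2y + 1, Z = 2z + 1, the equation of H₃ n says XY + YZ + ZX = 4n + 3, and
  -- that of F₃ n says A² + B² + C² = 4n + 3 for A = 2a + 1, B = 2b + 1, C = 2c + 1.
  F₃ H₃ : ℤ → V₃ → Set
  F₃ n (a , b , c) = pronic a + pronic b + pronic c ≡ n
  H₃ n (x , y , z) = 0ℤ ≤ x × 0ℤ ≤ y × 0ℤ ≤ z × x * y + y * z + z * x + (x + y + z) ≡ n

  F₃? : ∀ n → Decidable (F₃ n)
  F₃? n (a , b , c) = _ ℤ.≟ n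

  H₃? : ∀ n → Decidable (H₃ n)
  H₃? n (x , y , z) = 0ℤ ℤ.≤? x ×-dec 0ℤ ℤ.≤? y ×-dec 0ℤ ℤ.≤? z ×-dec _ ℤ.≟ n

  -- E is H in the coordinates p = x - j, q = y + j + 1. The part q < p of E with p, q positive is the part
  -- x = p + j ≥ 0 of U, and its part q < 0 corresponds to the part z < p - q of U.
  F H E U : ℤ → V → Set
  F m (j , t) = F₃ (m - pronic j) t
  H m (j , t) = H₃ (m - pronic j) t
  E m (j , p , q , z) = 0ℤ ≤ p + j × 0ℤ ≤ q - j - 1ℤ × 0ℤ ≤ z × p * q + p * (z - j) + q * (z + j + 1ℤ) ≡ m + 1ℤ
  U m (j , p , q , z) =
    0ℤ ≤ q - 1ℤ × 0ℤ ≤ p - q - 1ℤ × 0ℤ ≤ q - j - 1ℤ × 0ℤ ≤ z × p * q + p * (z - j) + q * (z + j + 1ℤ) ≡ m + 1ℤ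

  F? : ∀ m → Decidable (F m)
  F? m (j , t) = F₃? (m - pronic j) t

  H? : ∀ m → Decidable (H m)
  H? m (j , t) = H₃? (m - pronic j) t

  E? : ∀ m → Decidable (E m)
  E? m (j , p , q , z) = 0ℤ ℤ.≤? _ ×-dec 0ℤ ℤ.≤? _ ×-dec 0ℤ ℤ.≤? z ×-dec _ ℤ.≟ _

  U? : ∀ m → Decidable (U m)
  U? m (j , p , q , z) = 0ℤ ℤ.≤? _ ×-dec 0ℤ ℤ.≤? _ ×-dec 0ℤ ℤ.≤? _ ×-dec 0ℤ ℤ.≤? z ×-dec _ ℤ.≟ _

  -- Sums over the solutions inside a finite box.

  module Restricted {A : Set} (xs : List A) (unique : Unique xs) where

    S : ∀ {P : Pred A 0ℓ} → Decidable P → (A → ℤ) → ℤ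
    S P? f = ∑ xs (λ v → gate (P? v) (f v))

    module _ {P : Pred A 0ℓ} (P? : Decidable P) where

      S-cong : ∀ {f g} → (∀ {v} → P v → f v ≡ g v) → S P? f ≡ S P? g
      S-cong e = ∑-cong xs (λ v → gate-cong (P? v) e)

      S-zero : ∀ {f} → (∀ {v} → P v → f v ≡ 0ℤ) → S P? f ≡ 0ℤ
      S-zero e = trans (∑-cong xs (λ v → gate-zero (P? v) e)) (∑-0 xs)

      S-+ : ∀ f g → S P? (λ v → f v + g v) ≡ S P? f + S P? g
      S-+ f g = trans (∑-cong xs (λ v → gate-+ (P? v) (f v) (g v))) (∑-+ xs _ _)

      S-*ʳ : ∀ f c → S P? (λ v → f v * c) ≡ S P? f * c
      S-*ʳ f c = trans (∑-cong xs (λ v → gate-*ʳ (P? v) (f v) c)) (∑-*ʳ xs _ c)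

      S-split : ∀ {Q : Pred A 0ℓ} (Q? : Decidable Q) f →
        S P? f ≡ S (λ v → P? v ×-dec Q? v) f + S (λ v → P? v ×-dec ¬? (Q? v)) f
      S-split Q? f = trans (∑-cong xs (λ v → gate-split (P? v) (Q? v) (f v))) (∑-+ xs _ _)

    S-bijection : ∀ {P Q : Pred A 0ℓ} (P? : Decidable P) (Q? : Decidable Q) →
      (∀ {v} → P v → v ∈ xs) → (∀ {v} → Q v → v ∈ xs) →
      (φ ψ : A → A) → (∀ v → ψ (φ v) ≡ v) → (∀ v → φ (ψ v) ≡ v) →
      (∀ {v} → P v → Q (φ v)) → (∀ {v} → Q v → P (ψ v)) →
      (f : A → ℤ) → S P? (f ∘ φ) ≡ S Q? f
    S-bijection = ∑-bijection unique unique

  module Box (L : ℕ) where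

    abstract
      interval : List ℤ
      interval = map (λ k → + k - + L) (upTo (suc (L ℕ.+ L)))

      interval-unique : Unique interval
      interval-unique = Unique.map⁺ injective (Unique.upTo⁺ _)
        where
        undo : ∀ k l → k - l + l ≡ k
        undo = solve-∀
        injective : ∀ {k l} → + k - + L ≡ + l - + L → k ≡ l
        injective e = ℤ.+-injective (trans (sym (undo _ (+ L))) (trans (cong (_+ + L) e) (undo _ (+ L))))

      ∈-interval : ∀ {v} → 0ℤ ≤ + L - v → 0ℤ ≤ + L + v → v ∈ interval
      ∈-interval {v} v≤L -L≤v = subst (_∈ interval) v≡ (∈-map⁺ _ (∈-upTo⁺ k<))
        where
        k : ℕ
        k = ∣ + L + v ∣
        +k≡ : + k ≡ + L + v
        +k≡ = ℤ.0≤i⇒+∣i∣≡i -L≤v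
        shift : ∀ a b → a + b - a ≡ b
        shift = solve-∀
        slack : ∀ a b → a - b ≡ a + a - (a + b)
        slack = solve-∀
        v≡ : + k - + L ≡ v
        v≡ = trans (cong (_- + L) +k≡) (shift (+ L) v)
        k≤ : + k ≤ + (L ℕ.+ L)
        k≤ = ℤ.0≤i-j⇒j≤i (subst (λ i → 0ℤ ≤ + L + + L - i) (sym +k≡) (v≤L via slack (+ L) v))
        k< : k ℕ.< suc (L ℕ.+ L)
        k< = ℕ.s≤s (ℤ.drop‿+≤+ k≤)

    box₃ : List V₃
    box₃ = cartesianProduct interval (cartesianProduct interval interval)

    box : List V
    box = cartesianProduct interval box₃

    box-unique : Unique box
    box-unique = Unique.cartesianProduct⁺ interval-unique
      (Unique.cartesianProduct⁺ interval-unique (Unique.cartesianProduct⁺ interval-unique interval-unique))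


    open Restricted box box-unique public

  ≱0⁻ : ∀ {a} → 0ℤ ≤ - a - 1ℤ → ¬ 0ℤ ≤ a
  ≱0⁻ {a} h h′ = 0≰-1 ((h ⊕ h′) via cancel a)
    where
    0≰-1 : ¬ 0ℤ ≤ - 1ℤ
    0≰-1 ()
    cancel : ∀ a → - a - 1ℤ + a ≡ - 1ℤ
    cancel = solve-∀

  ≡0 : ∀ {a} → 0ℤ ≤ a → ¬ 0ℤ ≤ a - 1ℤ → a ≡ 0ℤ
  ≡0 {+ zero}  _ _ = refl
  ≡0 {+ suc n} _ h = ⊥-elim (h (+≥0 n))

  double≢1 : ∀ a → ¬ a + a ≡ 1ℤ
  double≢1 (+ suc n) e with () ← trans (sym (ℕ.+-suc n n)) (ℕ.suc-injective (ℤ.+-injective e))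

  -- The recurrences for the two counts.

  module Recurrences (L : ℕ) (m i : ℤ) (m≡2i : m ≡ i + i) (m≥0 : 0ℤ ≤ m)
    (m≤L : 0ℤ ≤ + L - (m + m + + 4)) where

    open Box L

    -- The variables of `F` and `H` have absolute value at most m + 1. The coordinates p = x - j and
    -- q = y + j + 1 of `E` combine two of them, which accounts for 2 m; the constant leaves some
    -- room.
    Bounded : ℤ → Set
    Bounded v = 0ℤ ≤ m + m + + 4 - v × 0ℤ ≤ m + m + + 4 + v

    ∈-box : ∀ {a b c d} → Bounded a → Bounded b → Bounded c → Bounded d → (a , b , c , d) ∈ box
    ∈-box a b c d = ∈-cartesianProduct⁺ (one a) (∈-cartesianProduct⁺ (one b) (∈-cartesianProduct⁺ (one c) (one d)))
      where
      upper : ∀ l k v → l - k + (k - v) ≡ l - v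
      upper = solve-∀
      lower : ∀ l k v → l - k + (k + v) ≡ l + v
      lower = solve-∀
      one : ∀ {v} → Bounded v → v ∈ interval
      one {v} (v≤ , ≤v) =
        ∈-interval ((m≤L ⊕ v≤) via upper (+ L) (m + m + + 4) v) ((m≤L ⊕ ≤v) via lower (+ L) (m + m + + 4) v)

    bounded : ∀ v → 0ℤ ≤ m + 1ℤ - v → 0ℤ ≤ m + 1ℤ + v → Bounded v
    bounded v v≤ ≤v =
      (m≥0 ⊕ v≤ ⊕ +≥0 3) via upper m v , (m≥0 ⊕ ≤v ⊕ +≥0 3) via lower m v
      where
      upper : ∀ m v → m + (m + 1ℤ - v) + + 3 ≡ m + m + + 4 - v
      upper = solve-∀
      lower : ∀ m v → m + (m + 1ℤ + v) + + 3 ≡ m + m + + 4 + v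
      lower = solve-∀

    pronic-bounded : ∀ v → 0ℤ ≤ m - pronic v → Bounded v
    pronic-bounded v h = bounded v
      ((h ⊕ square-nonneg v ⊕ +≥0 1) via upper m v)
      ((h ⊕ square-nonneg (v + 1ℤ)) via lower m v)
      where
      upper : ∀ m v → m - (v * v + v) + v * v + 1ℤ ≡ m + 1ℤ - v
      upper = solve-∀
      lower : ∀ m v → m - (v * v + v) + (v + 1ℤ) * (v + 1ℤ) ≡ m + 1ℤ + v
      lower = solve-∀

    exchange : ∀ a b c j → a + b + c ≡ m - j → j + b + c ≡ m - a
    exchange a b c j h = trans (lhs a b c j) (trans (cong (λ s → s + j - a) h) (rhs a j m))
      where
      lhs : ∀ a b c j → j + b + c ≡ a + b + c + j - a
      lhs = solve-∀
      rhs : ∀ a j m → m - j + j - a ≡ m - a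
      rhs = solve-∀

    swapα swapβ swapγ : V → V
    swapα (j , a , b , c) = a , j , b , c
    swapβ (j , a , b , c) = b , a , j , c
    swapγ (j , a , b , c) = c , a , b , j

    F-α : ∀ {v} → F m v → F m (swapα v)
    F-α {j , a , b , c} h = exchange (pronic a) (pronic b) (pronic c) (pronic j) h

    F-β : ∀ {v} → F m v → F m (swapβ v)
    F-β {j , a , b , c} h = trans (cong (_+ pronic c) (ℤ.+-comm (pronic a) (pronic j)))
      (exchange (pronic b) (pronic a) (pronic c) (pronic j)
        (trans (cong (_+ pronic c) (ℤ.+-comm (pronic b) (pronic a))) h))

    F-γ : ∀ {v} → F m v → F m (swapγ v)
    F-γ {j , a , b , c} h = trans (rotate (pronic a) (pronic b) (pronic j))
      (exchange (pronic c) (pronic a) (pronic b) (pronic j)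
        (trans (sym (rotate (pronic a) (pronic b) (pronic c))) h))
      where
      rotate : ∀ a b c → a + b + c ≡ c + a + b
      rotate = solve-∀

    F⊆box : ∀ {v} → F m v → v ∈ box
    F⊆box {v} h = ∈-box (first v h) (first (swapα v) (F-α {v} h)) (first (swapβ v) (F-β {v} h)) (first (swapγ v) (F-γ {v} h))
      where
      first : ∀ v → F m v → Bounded (proj₁ v)
      first (j , a , b , c) h = pronic-bounded j ((pronic-nonneg a ⊕ pronic-nonneg b ⊕ pronic-nonneg c) via h)

    HBounds : V → Set
    HBounds (j , x , y , z) =
      0ℤ ≤ m - x × 0ℤ ≤ m - y × 0ℤ ≤ m - z × 0ℤ ≤ m - j × 0ℤ ≤ m + 1ℤ + j

    -- Subtracting one of x, y, z from the equation leaves a sum of nonnegative terms. Subtracting j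
    -- leaves j² in place of j² + j, and adding j + 1 completes the square (j + 1)².
    H-bounds : ∀ {v} → H m v → HBounds v
    H-bounds {j , x , y , z} (x≥0 , y≥0 , z≥0 , h) =
        ((e₂ ⊕ (y≥0 ⊕ z≥0) ⊕ pj) via trans (t₁ x y z j) (cong (_- x) total))
      , ((e₂ ⊕ (x≥0 ⊕ z≥0) ⊕ pj) via trans (t₂ x y z j) (cong (_- y) total))
      , ((e₂ ⊕ (x≥0 ⊕ y≥0) ⊕ pj) via trans (t₃ x y z j) (cong (_- z) total))
      , ((e₂ ⊕ (x≥0 ⊕ y≥0 ⊕ z≥0) ⊕ square-nonneg j) via trans (t₄ x y z j) (cong (_- j) total))
      , ((e₂ ⊕ (x≥0 ⊕ y≥0 ⊕ z≥0) ⊕ square-nonneg (j + 1ℤ)) via trans (t₅ x y z j) (cong (λ s → s + 1ℤ + j) total))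
      where
      pj = pronic-nonneg j
      e₂ : 0ℤ ≤ x * y + y * z + z * x
      e₂ = x≥0 ⊗ y≥0 ⊕ y≥0 ⊗ z≥0 ⊕ z≥0 ⊗ x≥0
      total : x * y + y * z + z * x + (x + y + z) + (j * j + j) ≡ m
      total = trans (cong (_+ (j * j + j)) h) (undo m (j * j + j))
        where
        undo : ∀ a b → a - b + b ≡ a
        undo = solve-∀
      t₁ : ∀ x y z j → x * y + y * z + z * x + (y + z) + (j * j + j) ≡ x * y + y * z + z * x + (x + y + z) + (j * j + j) - x
      t₁ = solve-∀
      t₂ : ∀ x y z j → x * y + y * z + z * x + (x + z) + (j * j + j) ≡ x * y + y * z + z * x + (x + y + z) + (j * j + j) - y
      t₂ = solve-∀
      t₃ : ∀ x y z j → x * y + y * z + z * x + (x + y) + (j * j + j) ≡ x * y + y * z + z * x + (x + y + z) + (j * j + j) - z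
      t₃ = solve-∀
      t₄ : ∀ x y z j → x * y + y * z + z * x + (x + y + z) + j * j ≡ x * y + y * z + z * x + (x + y + z) + (j * j + j) - j
      t₄ = solve-∀
      t₅ : ∀ x y z j → x * y + y * z + z * x + (x + y + z) + (j + 1ℤ) * (j + 1ℤ) ≡ x * y + y * z + z * x + (x + y + z) + (j * j + j) + 1ℤ + j
      t₅ = solve-∀

    H⊆box : ∀ {v} → H m v → v ∈ box
    H⊆box {j , x , y , z} h@(x≥0 , y≥0 , z≥0 , _) =
      let x≤ , y≤ , z≤ , j≤ , ≤j = H-bounds {j , x , y , z} h in ∈-box (bounded j (widen j≤) ≤j) (pos x≥0 x≤) (pos y≥0 y≤) (pos z≥0 z≤)
      where
      step : ∀ m v → m - v + 1ℤ ≡ m + 1ℤ - v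
      step = solve-∀
      widen : ∀ {v} → 0ℤ ≤ m - v → 0ℤ ≤ m + 1ℤ - v
      widen {v} v≤ = (v≤ ⊕ +≥0 1) via step m v
      pos : ∀ {v} → 0ℤ ≤ v → 0ℤ ≤ m - v → Bounded v
      pos {v} v≥0 v≤ = bounded v (widen v≤) (m≥0 ⊕ +≥0 1 ⊕ v≥0)

    shear unshear : V → V
    shear   (j , x , y , z) = j , x - j , y + j + 1ℤ , z
    unshear (j , p , q , z) = j , p + j , q - j - 1ℤ , z

    cong-pq : ∀ {j p p′ q q′ z : ℤ} → p ≡ p′ → q ≡ q′ → _≡_ {A = V} (j , p , q , z) (j , p′ , q′ , z)
    cong-pq refl refl = refl

    x≡ : ∀ x j → x ≡ x - j + j
    x≡ = solve-∀

    y≡ : ∀ y j → y ≡ y + j + 1ℤ - j - 1ℤ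
    y≡ = solve-∀

    unshear-shear : ∀ v → unshear (shear v) ≡ v
    unshear-shear (j , x , y , z) = cong-pq (sym (x≡ x j)) (sym (y≡ y j))

    shear-unshear : ∀ v → shear (unshear v) ≡ v
    shear-unshear (j , p , q , z) = cong-pq (p≡ p j) (q≡ q j)
      where
      p≡ : ∀ p j → p + j - j ≡ p
      p≡ = solve-∀
      q≡ : ∀ q j → q - j - 1ℤ + j + 1ℤ ≡ q
      q≡ = solve-∀

    H⇒E : ∀ {v} → H m v → E m (shear v)
    H⇒E {j , x , y , z} (x≥0 , y≥0 , z≥0 , h) =
      x≥0 via x≡ x j , y≥0 via y≡ y j , z≥0 ,
      trans (expand j x y z) (trans (cong (λ s → s + (j * j + j) + 1ℤ) h) (undo m (j * j + j)))
      where
      expand : ∀ j x y z → (x - j) * (y + j + 1ℤ) + (x - j) * (z - j) + (y + j + 1ℤ) * (z + j + 1ℤ)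
                         ≡ x * y + y * z + z * x + (x + y + z) + (j * j + j) + 1ℤ
      expand = solve-∀
      undo : ∀ m s → m - s + s + 1ℤ ≡ m + 1ℤ
      undo = solve-∀

    E⇒H : ∀ {v} → E m v → H m (unshear v)
    E⇒H {j , p , q , z} (x≥0 , y≥0 , z≥0 , e) =
      x≥0 , y≥0 , z≥0 , trans (expand j p q z) (trans (cong (λ s → s - 1ℤ - (j * j + j)) e) (undo m (j * j + j)))
      where
      expand : ∀ j p q z → (p + j) * (q - j - 1ℤ) + (q - j - 1ℤ) * z + z * (p + j) + (p + j + (q - j - 1ℤ) + z)
                         ≡ p * q + p * (z - j) + q * (z + j + 1ℤ) - 1ℤ - (j * j + j)
      expand = solve-∀
      undo : ∀ m s → m + 1ℤ - 1ℤ - s ≡ m - s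
      undo = solve-∀

    E⊆box : ∀ {v} → E m v → v ∈ box
    E⊆box {j , p , q , z} e@(x≥0 , y≥0 , z≥0 , _) =
      let x≤ , y≤ , z≤ , j≤ , ≤j = H-bounds {unshear (j , p , q , z)} (E⇒H {j , p , q , z} e) in ∈-box
      (bounded j ((j≤ ⊕ +≥0 1) via widen m j) ≤j)
      (((x≤ ⊕ ≤j ⊕ +≥0 3) via p≤ m p j) , ((x≥0 ⊕ j≤ ⊕ m≥0 ⊕ +≥0 4) via ≤p m p j))
      (((y≤ ⊕ j≤ ⊕ +≥0 3) via q≤ m q j) , ((y≥0 ⊕ ≤j ⊕ m≥0 ⊕ +≥0 4) via ≤q m q j))
      (bounded z ((z≤ ⊕ +≥0 1) via widen m z) (m≥0 ⊕ +≥0 1 ⊕ z≥0))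
      where
      widen : ∀ m v → m - v + 1ℤ ≡ m + 1ℤ - v
      widen = solve-∀
      p≤ : ∀ m p j → m - (p + j) + (m + 1ℤ + j) + + 3 ≡ m + m + + 4 - p
      p≤ = solve-∀
      ≤p : ∀ m p j → p + j + (m - j) + m + + 4 ≡ m + m + + 4 + p
      ≤p = solve-∀
      q≤ : ∀ m q j → m - (q - j - 1ℤ) + (m - j) + + 3 ≡ m + m + + 4 - q
      q≤ = solve-∀
      ≤q : ∀ m q j → q - j - 1ℤ + (m + 1ℤ + j) + m + + 4 ≡ m + m + + 4 + q
      ≤q = solve-∀

    -- With r = q - j - 1 the left side of the equation is (p + q) z + (p - q) r + q² + p. All terms
    -- are nonnegative, and since q ≥ 1 and p - q ≥ 1 they bound p, z and r; then q < p and j = q -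
    -- r - 1 are bounded too.
    U⊆box : ∀ {v} → U m v → v ∈ box
    U⊆box {j , p , q , z} (q>0 , q<p , r≥0 , z≥0 , e) = ∈-box
      ((p≤ ⊕ d≥0 ⊕ r≥0 ⊕ m≥0 ⊕ +≥0 4) via j≤ m p q j , (r≤ ⊕ m≥0 ⊕ +≥0 2 ⊕ q≥0) via ≤j m q j)
      (bounded p p≤ (m≥0 ⊕ +≥0 1 ⊕ p≥0))
      (bounded q ((p≤ ⊕ d≥0) via q≤ m p q) (m≥0 ⊕ +≥0 1 ⊕ q≥0))
      (bounded z z≤ (m≥0 ⊕ +≥0 1 ⊕ z≥0))
      where
      j≤ : ∀ m p q j → m + 1ℤ - p + (p - q) + (q - j - 1ℤ) + m + + 4 ≡ m + m + + 4 - j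
      j≤ = solve-∀
      ≤j : ∀ m q j → m + 1ℤ - (q - j - 1ℤ) + m + + 2 + q ≡ m + m + + 4 + j
      ≤j = solve-∀
      q≤ : ∀ m p q → m + 1ℤ - p + (p - q) ≡ m + 1ℤ - q
      q≤ = solve-∀
      pred-suc : ∀ q → q - 1ℤ + 1ℤ ≡ q
      pred-suc = solve-∀
      sub-add : ∀ p q → p - q + q ≡ p
      sub-add = solve-∀
      q≥0 : 0ℤ ≤ q
      q≥0 = (q>0 ⊕ +≥0 1) via pred-suc q
      d≥0 : 0ℤ ≤ p - q
      d≥0 = (q<p ⊕ +≥0 1) via pred-suc (p - q)
      p≥0 : 0ℤ ≤ p
      p≥0 = (d≥0 ⊕ q≥0) via sub-add p q
      p≤ : 0ℤ ≤ m + 1ℤ - p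
      p≤ = ((p≥0 ⊕ q≥0) ⊗ z≥0 ⊕ d≥0 ⊗ r≥0 ⊕ q≥0 ⊗ q≥0) via trans (t j p q z) (cong (_- p) e)
        where
        t : ∀ j p q z → (p + q) * z + (p - q) * (q - j - 1ℤ) + q * q ≡ p * q + p * (z - j) + q * (z + j + 1ℤ) - p
        t = solve-∀
      z≤ : 0ℤ ≤ m + 1ℤ - z
      z≤ = ((p≥0 ⊕ q>0) ⊗ z≥0 ⊕ d≥0 ⊗ r≥0 ⊕ q≥0 ⊗ q≥0 ⊕ p≥0) via trans (t j p q z) (cong (_- z) e)
        where
        t : ∀ j p q z → (p + (q - 1ℤ)) * z + (p - q) * (q - j - 1ℤ) + q * q + p ≡ p * q + p * (z - j) + q * (z + j + 1ℤ) - z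
        t = solve-∀
      r≤ : 0ℤ ≤ m + 1ℤ - (q - j - 1ℤ)
      r≤ = ((p≥0 ⊕ q≥0) ⊗ z≥0 ⊕ q<p ⊗ r≥0 ⊕ q≥0 ⊗ q≥0 ⊕ p≥0) via trans (t j p q z) (cong (_- (q - j - 1ℤ)) e)
        where
        t : ∀ j p q z → (p + q) * z + (p - q - 1ℤ) * (q - j - 1ℤ) + q * q + p ≡ p * q + p * (z - j) + q * (z + j + 1ℤ) - (q - j - 1ℤ)
        t = solve-∀

    -- The recurrence for sums of three pronic numbers.

    weight : V → ℤ
    weight (j , _) = m - pronic j * + 4

    -- On a solution the weight equals the pronic numbers of a, b, c minus three times that of j.
    -- Exchanging j with any other variable preserves `F`, so all four pronic sums agree and cancel.
    F-recurrence : S (F? m) weight ≡ 0ℤ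
    F-recurrence = begin
      S (F? m) weight
        ≡⟨ S-cong (F? m) {weight} {λ v → α v + (β v + (γ v + ι v * - + 3))} (λ {v} h → expand v h) ⟩
      S (F? m) (λ v → α v + (β v + (γ v + ι v * - + 3)))
        ≡⟨ trans (S-+ (F? m) α _) (cong (λ s → S (F? m) α + s)
             (trans (S-+ (F? m) β _) (cong (λ s → S (F? m) β + s)
               (trans (S-+ (F? m) γ _) (cong (λ s → S (F? m) γ + s) (S-*ʳ (F? m) ι (- + 3))))))) ⟩
      S (F? m) α + (S (F? m) β + (S (F? m) γ + S (F? m) ι * - + 3))
        ≡⟨ cong₂ _+_ Sα (cong₂ _+_ Sβ (cong (λ c → c + S (F? m) ι * - + 3) Sγ)) ⟩
      S (F? m) ι + (S (F? m) ι + (S (F? m) ι + S (F? m) ι * - + 3))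
        ≡⟨ cancel (S (F? m) ι) ⟩
      0ℤ ∎
      where
      open ≡-Reasoning
      ι α β γ : V → ℤ
      ι (j , a , b , c) = pronic j
      α (j , a , b , c) = pronic a
      β (j , a , b , c) = pronic b
      γ (j , a , b , c) = pronic c
      cancel : ∀ s → s + (s + (s + s * - + 3)) ≡ 0ℤ
      cancel = solve-∀
      expand : ∀ v → F m v → weight v ≡ α v + (β v + (γ v + ι v * - + 3))
      expand (j , a , b , c) h = trans (split m (pronic j)) (trans (cong (λ s → s + pronic j * - + 3) (sym h))
          (assoc (pronic a) (pronic b) (pronic c) (pronic j * - + 3)))
        where
        split : ∀ m j → m - j * + 4 ≡ m - j + j * - + 3
        split = solve-∀
        assoc : ∀ a b c d → a + b + c + d ≡ a + (b + (c + d))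
        assoc = solve-∀
      by-swap : (swap : V → V) → (∀ v → swap (swap v) ≡ v) → (∀ {v} → F m v → F m (swap v)) →
        S (F? m) (ι ∘ swap) ≡ S (F? m) ι
      by-swap swap inv Fs = S-bijection (F? m) (F? m) F⊆box F⊆box swap swap inv inv Fs Fs ι
      Sα : S (F? m) α ≡ S (F? m) ι
      Sα = by-swap swapα (λ _ → refl) (λ {v} → F-α {v})
      Sβ : S (F? m) β ≡ S (F? m) ι
      Sβ = by-swap swapβ (λ _ → refl) (λ {v} → F-β {v})
      Sγ : S (F? m) γ ≡ S (F? m) ι
      Sγ = by-swap swapγ (λ _ → refl) (λ {v} → F-γ {v})

    -- The sum of p q over `E`, and the recurrence for `H`.

    product : V → ℤ
    product (j , p , q , z) = p * q

    -- With s = z - j and t = z + j + 1 the equation of E reads pq + ps + qt = m + 1. Then τ exchanges (p , s)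
    -- with (q , t), σ maps (s , t) to (s + 2q , t - 2p), and β maps (q , s , t) to (- q , s + 2q , - t).
    τ β σ σ⁻¹ : V → V
    τ   (j , p , q , z) = - 1ℤ - j , q , p , z
    β   (j , p , q , z) = - q - z - 1ℤ , p , - q , q - j - 1ℤ
    σ   (j , p , q , z) = j - (p + q) , p , q , z - (p - q)
    σ⁻¹ (j , p , q , z) = j + (p + q) , p , q , z + (p - q)

    cong-jz : ∀ {j j′ p q z z′ : ℤ} → j ≡ j′ → z ≡ z′ → _≡_ {A = V} (j , p , q , z) (j′ , p , q , z′)
    cong-jz refl refl = refl

    sub-add : ∀ a b → a - b + b ≡ a
    sub-add = solve-∀

    add-sub : ∀ a b → a + b - b ≡ a
    add-sub = solve-∀

    ττ : ∀ v → τ (τ v) ≡ v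
    ττ (j , p , q , z) = cong (_, (p , q , z)) (t j)
      where
      t : ∀ j → - 1ℤ - (- 1ℤ - j) ≡ j
      t = solve-∀

    ββ : ∀ v → β (β v) ≡ v
    ββ (j , p , q , z) = trans (cong (λ r → - - q - (q - j - 1ℤ) - 1ℤ , p , r , - q - (- q - z - 1ℤ) - 1ℤ) (ℤ.neg-involutive q))
        (cong-jz (tj j q) (tz q z))
      where
      tj : ∀ j q → - - q - (q - j - 1ℤ) - 1ℤ ≡ j
      tj = solve-∀
      tz : ∀ q z → - q - (- q - z - 1ℤ) - 1ℤ ≡ z
      tz = solve-∀

    σ⁻¹σ : ∀ v → σ⁻¹ (σ v) ≡ v
    σ⁻¹σ (j , p , q , z) = cong-jz (sub-add j (p + q)) (sub-add z (p - q))

    σσ⁻¹ : ∀ v → σ (σ⁻¹ v) ≡ v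
    σσ⁻¹ (j , p , q , z) = cong-jz (add-sub j (p + q)) (add-sub z (p - q))

    q≥0 p≥0 x≥0 z≥d q<p p<q : V → Set
    q≥0 (j , p , q , z) = 0ℤ ≤ q
    p≥0 (j , p , q , z) = 0ℤ ≤ p
    x≥0 (j , p , q , z) = 0ℤ ≤ p + j
    z≥d (j , p , q , z) = 0ℤ ≤ z - (p - q)
    q<p (j , p , q , z) = 0ℤ ≤ q - 1ℤ × 0ℤ ≤ p - q - 1ℤ
    p<q (j , p , q , z) = 0ℤ ≤ p - 1ℤ × 0ℤ ≤ q - p - 1ℤ

    q≥0? : Decidable q≥0
    q≥0? (j , p , q , z) = 0ℤ ℤ.≤? q
    p≥0? : Decidable p≥0
    p≥0? (j , p , q , z) = 0ℤ ℤ.≤? p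
    x≥0? : Decidable x≥0
    x≥0? (j , p , q , z) = 0ℤ ℤ.≤? p + j
    z≥d? : Decidable z≥d
    z≥d? (j , p , q , z) = 0ℤ ℤ.≤? z - (p - q)
    q<p? : Decidable q<p
    q<p? (j , p , q , z) = 0ℤ ℤ.≤? q - 1ℤ ×-dec 0ℤ ℤ.≤? p - q - 1ℤ
    p<q? : Decidable p<q
    p<q? (j , p , q , z) = 0ℤ ℤ.≤? p - 1ℤ ×-dec 0ℤ ℤ.≤? q - p - 1ℤ

    infixl 7 _∩?_ _∖?_
    _∩?_ : ∀ {P Q : Pred V 0ℓ} → Decidable P → Decidable Q → Decidable (λ v → P v × Q v)
    (P? ∩? Q?) v = P? v ×-dec Q? v
    _∖?_ : ∀ {P Q : Pred V 0ℓ} → Decidable P → Decidable Q → Decidable (λ v → P v × ¬ Q v)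
    (P? ∖? Q?) v = P? v ×-dec ¬? (Q? v)

    -- In the coordinates x = p + j and y = q - j - 1, `τ` swaps x with y, reflects j to -1 - j and
    -- fixes z.
    E-τ : ∀ {v} → E m v → E m (τ v)
    E-τ {j , p , q , z} (x , y , z≥0 , e) = y via y≡x q j , x via x≡y p j , z≥0 , trans (t j p q z) e
      where
      y≡x : ∀ q j → q - j - 1ℤ ≡ q + (- 1ℤ - j)
      y≡x = solve-∀
      x≡y : ∀ p j → p + j ≡ p - (- 1ℤ - j) - 1ℤ
      x≡y = solve-∀
      t : ∀ j p q z → q * p + q * (z - (- 1ℤ - j)) + p * (z + (- 1ℤ - j) + 1ℤ) ≡ p * q + p * (z - j) + q * (z + j + 1ℤ)
      t = solve-∀

    β-equation : ∀ j p q z →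
      p * (- q) + p * (q - j - 1ℤ - (- q - z - 1ℤ)) + (- q) * (q - j - 1ℤ + (- q - z - 1ℤ) + 1ℤ)
        ≡ p * q + p * (z - j) + q * (z + j + 1ℤ)
    β-equation = solve-∀

    -- With x = p + j and y = q - j - 1, the map `β` trades the bounds y ≥ 0 and z ≥ 0 for each
    -- other and turns x ≥ 0 into z < p - q at the image. The image has q < p because x + y = p + q
    -- - 1 is nonnegative.
    E⇒U : ∀ {v} → E m v × ¬ q≥0 v → U m (β v) × ¬ z≥d (β v)
    E⇒U {j , p , q , z} ((x , y , z≥0 , e) , q<0) =
      (≱0 q<0 , (x ⊕ y) via t₁ p q j , z≥0 via t₂ q z , y , trans (β-equation j p q z) e) ,
      ≱0⁻ (x via t₃ p q j)
      where
      t₁ : ∀ p q j → p + j + (q - j - 1ℤ) ≡ p - - q - 1ℤ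
      t₁ = solve-∀
      t₂ : ∀ q z → z ≡ - q - (- q - z - 1ℤ) - 1ℤ
      t₂ = solve-∀
      t₃ : ∀ p q j → p + j ≡ - (q - j - 1ℤ - (p - - q)) - 1ℤ
      t₃ = solve-∀

    U⇒E : ∀ {v} → U m v × ¬ z≥d v → E m (β v) × ¬ q≥0 (β v)
    U⇒E {j , p , q , z} ((q>0 , _ , y , z≥0 , e) , z<d) =
      (≱0 z<d via t₁ p q z , z≥0 via t₂ q z , y , trans (β-equation j p q z) e) , ≱0⁻ (q>0 via t₃ q)
      where
      t₁ : ∀ p q z → - (z - (p - q)) - 1ℤ ≡ p + (- q - z - 1ℤ)
      t₁ = solve-∀
      t₂ : ∀ q z → z ≡ - q - (- q - z - 1ℤ) - 1ℤ
      t₂ = solve-∀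
      t₃ : ∀ q → q - 1ℤ ≡ - - q - 1ℤ
      t₃ = solve-∀

    σ-equation : ∀ j p q z →
      p * q + p * (z - (p - q) - (j - (p + q))) + q * (z - (p - q) + (j - (p + q)) + 1ℤ)
        ≡ p * q + p * (z - j) + q * (z + j + 1ℤ)
    σ-equation = solve-∀

    σ⁻¹-equation : ∀ j p q z →
      p * q + p * (z + (p - q) - (j + (p + q))) + q * (z + (p - q) + (j + (p + q)) + 1ℤ)
        ≡ p * q + p * (z - j) + q * (z + j + 1ℤ)
    σ⁻¹-equation = solve-∀

    -- The new z is z - (p - q), so `z≥d` is exactly its nonnegativity. The new p + j is j - q,
    -- which q - j - 1 ≥ 0 makes negative.
    U-σ : ∀ {v} → U m v × z≥d v → U m (σ v) × ¬ x≥0 (σ v)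
    U-σ {j , p , q , z} ((q>0 , d , y , z≥0 , e) , z≥) =
      (q>0 , d , (y ⊕ q>0 ⊕ q>0 ⊕ d ⊕ +≥0 3) via t₁ j p q , z≥ , trans (σ-equation j p q z) e) , ≱0⁻ (y via t₂ j p q)
      where
      t₁ : ∀ j p q → q - j - 1ℤ + (q - 1ℤ) + (q - 1ℤ) + (p - q - 1ℤ) + + 3 ≡ q - (j - (p + q)) - 1ℤ
      t₁ = solve-∀
      t₂ : ∀ j p q → q - j - 1ℤ ≡ - (p + (j - (p + q))) - 1ℤ
      t₂ = solve-∀

    U-σ⁻¹ : ∀ {v} → U m v × ¬ x≥0 v → U m (σ⁻¹ v) × z≥d (σ⁻¹ v)
    U-σ⁻¹ {j , p , q , z} ((q>0 , d , y , z≥0 , e) , x<0) =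
      (q>0 , d , ≱0 x<0 via t₁ j p q , (z≥0 ⊕ d ⊕ +≥0 1) via t₂ p q z , trans (σ⁻¹-equation j p q z) e) ,
      z≥0 via sym (add-sub z (p - q))
      where
      t₁ : ∀ j p q → - (p + j) - 1ℤ ≡ q - (j + (p + q)) - 1ℤ
      t₁ = solve-∀
      t₂ : ∀ p q z → z + (p - q - 1ℤ) + 1ℤ ≡ z + (p - q)
      t₂ = solve-∀

    0<q⇒0≤q : ∀ {q} → 0ℤ ≤ q - 1ℤ → 0ℤ ≤ q
    0<q⇒0≤q {q} h = (h ⊕ +≥0 1) via sub-add q 1ℤ

    p>0 : ∀ {p q} → 0ℤ ≤ q - 1ℤ → 0ℤ ≤ p - q - 1ℤ → 0ℤ ≤ p - 1ℤ
    p>0 {p} {q} h d = (h ⊕ d ⊕ +≥0 1) via t p q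
      where
      t : ∀ p q → q - 1ℤ + (p - q - 1ℤ) + 1ℤ ≡ p - 1ℤ
      t = solve-∀

    E₊? = E? m ∩? q≥0? ∩? p≥0?

    toUx : ∀ {v} → ((E m v × q≥0 v) × p≥0 v) × q<p v → U m v × x≥0 v
    toUx {j , p , q , z} ((((x , y , z≥0 , e) , _) , _) , (q>0 , d)) = (q>0 , d , y , z≥0 , e) , x

    fromUx : ∀ {v} → U m v × x≥0 v → ((E m v × q≥0 v) × p≥0 v) × q<p v
    fromUx {j , p , q , z} ((q>0 , d , y , z≥0 , e) , x) =
      (((x , y , z≥0 , e) , 0<q⇒0≤q q>0) , 0<q⇒0≤q (p>0 {p} {q} q>0 d)) , (q>0 , d)

    toUx-τ : ∀ {v} → (((E m v × q≥0 v) × p≥0 v) × ¬ q<p v) × p<q v → U m (τ v) × x≥0 (τ v)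
    toUx-τ {j , p , q , z} ((((e , q≥) , p≥) , _) , lt) = toUx {τ (j , p , q , z)} (((E-τ {j , p , q , z} e , p≥) , q≥) , lt)

    fromUx-τ : ∀ {v} → U m v × x≥0 v → (((E m (τ v) × q≥0 (τ v)) × p≥0 (τ v)) × ¬ q<p (τ v)) × p<q (τ v)
    fromUx-τ {j , p , q , z} u with ((e , q≥) , p≥) , lt@(_ , d) ← fromUx {j , p , q , z} u =
      (((E-τ {j , p , q , z} e , p≥) , q≥) , λ (_ , d′) → ≱0⁻ {p - q - 1ℤ} ((d′ ⊕ +≥0 1) via t p q) d) , lt
      where
      t : ∀ p q → q - p - 1ℤ + 1ℤ ≡ - (p - q - 1ℤ) - 1ℤ
      t = solve-∀

    -- For p = q the left side of the equation is p² + p + 2pz, which is even, while m + 1 is odd.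
    no-diagonal : ∀ j p z → ¬ p * p + p * (z - j) + p * (z + j + 1ℤ) ≡ m + 1ℤ
    no-diagonal j p z e = double≢1 (+ t + p * z - i) (begin
      + t + p * z - i + (+ t + p * z - i)
        ≡⟨ rearrange (+ t) (p * z) i ⟩
      + t + + t + (p * z + p * z) - (i + i)
        ≡⟨ cong (λ s → s + (p * z + p * z) - (i + i)) (pronic≡ p) ⟨
      pronic p + (p * z + p * z) - (i + i)
        ≡⟨ collect j p z (i + i) ⟩
      p * p + p * (z - j) + p * (z + j + 1ℤ) - (i + i)
        ≡⟨ cong₂ _-_ (trans e (cong (_+ 1ℤ) m≡2i)) refl ⟩
      i + i + 1ℤ - (i + i)
        ≡⟨ cancel (i + i) ⟩
      1ℤ ∎)
      where
      open ≡-Reasoning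
      t = triangle (index p)
      rearrange : ∀ t s i → t + s - i + (t + s - i) ≡ t + t + (s + s) - (i + i)
      rearrange = solve-∀
      collect : ∀ j p z m → p * p + p + (p * z + p * z) - m ≡ p * p + p * (z - j) + p * (z + j + 1ℤ) - m
      collect = solve-∀
      cancel : ∀ m → m + 1ℤ - m ≡ 1ℤ
      cancel = solve-∀

    -- What is left of p, q ≥ 0 has p = 0, q = 0 or p = q > 0. The last case is excluded by
    -- `no-diagonal`; this is where the evenness of m enters.
    rest-zero : ∀ {v} → (((E m v × q≥0 v) × p≥0 v) × ¬ q<p v) × ¬ p<q v → product v ≡ 0ℤ
    rest-zero {j , p , q , z} (((((_ , _ , _ , e) , q≥) , p≥) , ¬q<p) , ¬p<q)
      with 0ℤ ℤ.≤? q - 1ℤ | 0ℤ ℤ.≤? p - 1ℤ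
    ... | no q≤0 | _       = trans (cong (p *_) (≡0 q≥ q≤0)) (ℤ.*-zeroʳ p)
    ... | yes _  | no p≤0  = trans (cong (_* q) (≡0 p≥ p≤0)) (ℤ.*-zeroˡ q)
    ... | yes q>0 | yes p>0 = ⊥-elim (no-diagonal j p z
            (subst (λ r → p * r + p * (z - j) + r * (z + j + 1ℤ) ≡ m + 1ℤ) (sym p≡q) e))
      where
      t : ∀ p q → - (p - q) - 1ℤ ≡ q - p - 1ℤ
      t = solve-∀
      p-q≥0 : 0ℤ ≤ p - q
      p-q≥0 with 0ℤ ℤ.≤? p - q
      ... | yes h = h
      ... | no  h = ⊥-elim (¬p<q (p>0 , (≱0 h via t p q)))
      p≡q : p ≡ q
      p≡q = ℤ.i-j≡0⇒i≡j p q (≡0 p-q≥0 (λ d → ¬q<p (q>0 , d)))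

    -- The regions 0 < q < p and 0 < p < q each contribute the sum of p q over the part x ≥ 0 of
    -- `U`. The regions q < 0 and p < 0 each contribute minus the sum over the part z < p - q of
    -- `U`, as `β` changes the sign of q. By `shifted` the contributions cancel.
    E-sum : S (E? m) product ≡ 0ℤ
    E-sum = begin
      S (E? m) product
        ≡⟨ S-split (E? m) q≥0? product ⟩
      S (E? m ∩? q≥0?) product + S (E? m ∖? q≥0?) product
        ≡⟨ cong₂ _+_ (S-split (E? m ∩? q≥0?) p≥0? product) refl ⟩
      S E₊? product + S (E? m ∩? q≥0? ∖? p≥0?) product + S (E? m ∖? q≥0?) product
        ≡⟨ cong (λ s → s + S (E? m ∩? q≥0? ∖? p≥0?) product + S (E? m ∖? q≥0?) product)
             (trans (S-split E₊? q<p? product) (cong (λ s → S (E₊? ∩? q<p?) product + s) (S-split (E₊? ∖? q<p?) p<q? product))) ⟩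
      S (E₊? ∩? q<p?) product + (S (E₊? ∖? q<p? ∩? p<q?) product + S (E₊? ∖? q<p? ∖? p<q?) product)
        + S (E? m ∩? q≥0? ∖? p≥0?) product + S (E? m ∖? q≥0?) product
        ≡⟨ cong₂ _+_ (cong₂ _+_ (cong₂ _+_ left (cong₂ _+_ right
             (S-zero (E₊? ∖? q<p? ∖? p<q?) (λ {v} → rest-zero {v})))) p-negative) q-negative ⟩
      S (U? m ∩? x≥0?) product + (S (U? m ∩? x≥0?) product + 0ℤ)
        + S (U? m ∖? z≥d?) product * - 1ℤ + S (U? m ∖? z≥d?) product * - 1ℤ
        ≡⟨ cong (λ u → u + (u + 0ℤ) + S (U? m ∖? z≥d?) product * - 1ℤ + S (U? m ∖? z≥d?) product * - 1ℤ) shifted ⟩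
      S (U? m ∖? z≥d?) product + (S (U? m ∖? z≥d?) product + 0ℤ)
        + S (U? m ∖? z≥d?) product * - 1ℤ + S (U? m ∖? z≥d?) product * - 1ℤ
        ≡⟨ cancel (S (U? m ∖? z≥d?) product) ⟩
      0ℤ ∎
      where
      open ≡-Reasoning
      cancel : ∀ u → u + (u + 0ℤ) + u * - 1ℤ + u * - 1ℤ ≡ 0ℤ
      cancel = solve-∀
      left : S (E₊? ∩? q<p?) product ≡ S (U? m ∩? x≥0?) product
      left = S-bijection (E₊? ∩? q<p?) (U? m ∩? x≥0?) (λ { {v} (((e , _) , _) , _) → E⊆box {v} e })
          (λ { {v} (u , _) → U⊆box {v} u })
        (λ v → v) (λ v → v) (λ _ → refl) (λ _ → refl) (λ {v} → toUx {v}) (λ {v} → fromUx {v}) product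
      right : S (E₊? ∖? q<p? ∩? p<q?) product ≡ S (U? m ∩? x≥0?) product
      right = trans (S-cong (E₊? ∖? q<p? ∩? p<q?) (λ { {j , p , q , z} _ → ℤ.*-comm p q }))
        (S-bijection (E₊? ∖? q<p? ∩? p<q?) (U? m ∩? x≥0?) (λ { {v} ((((e , _) , _) , _) , _) → E⊆box {v} e })
          (λ { {v} (u , _) → U⊆box {v} u })
          τ τ ττ ττ (λ {v} → toUx-τ {v}) (λ {v} → fromUx-τ {v}) product)
      q-negative : S (E? m ∖? q≥0?) product ≡ S (U? m ∖? z≥d?) product * - 1ℤ
      q-negative = begin
        S (E? m ∖? q≥0?) product                         ≡⟨ S-cong (E? m ∖? q≥0?) (λ { {j , p , q , z} _ → t p q }) ⟩
        S (E? m ∖? q≥0?) (λ v → product (β v) * - 1ℤ)    ≡⟨ S-*ʳ (E? m ∖? q≥0?) (product ∘ β) (- 1ℤ) ⟩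
        S (E? m ∖? q≥0?) (product ∘ β) * - 1ℤ            ≡⟨ cong (_* - 1ℤ) (S-bijection (E? m ∖? q≥0?) (U? m ∖? z≥d?)
          (λ { {v} (e , _) → E⊆box {v} e })
          (λ { {v} (u , _) → U⊆box {v} u }) β β ββ ββ (λ {v} → E⇒U {v}) (λ {v} → U⇒E {v}) product) ⟩
        S (U? m ∖? z≥d?) product * - 1ℤ                  ∎
        where
        t : ∀ p q → p * q ≡ p * (- q) * - 1ℤ
        t = solve-∀
      p-negative : S (E? m ∩? q≥0? ∖? p≥0?) product ≡ S (U? m ∖? z≥d?) product * - 1ℤ
      p-negative = trans (trans (S-cong (E? m ∩? q≥0? ∖? p≥0?) (λ { {j , p , q , z} _ → ℤ.*-comm p q }))
        (S-bijection (E? m ∩? q≥0? ∖? p≥0?) (E? m ∖? q≥0?) (λ { {v} ((e , _) , _) → E⊆box {v} e }) (λ { {v} (e , _) → E⊆box {v} e })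
          τ τ ττ ττ (λ { {v} ((e , _) , p<0) → E-τ {v} e , p<0 }) (λ {v} → back {v}) product)) q-negative
        where
        back : ∀ {v} → E m v × ¬ q≥0 v → (E m (τ v) × q≥0 (τ v)) × ¬ p≥0 (τ v)
        -- p + q = x + y + 1 is positive, so p and q are never both negative.
        back {j , p , q , z} (e@(x , y , _) , q<0) = (E-τ {j , p , q , z} e , (x ⊕ y ⊕ ≱0 q<0 ⊕ +≥0 2) via t p q j) , q<0
          where
          t : ∀ p q j → p + j + (q - j - 1ℤ) + (- q - 1ℤ) + + 2 ≡ p
          t = solve-∀
      -- The complements in U of the two regions are exchanged by σ, which fixes p and q.
      shifted : S (U? m ∩? x≥0?) product ≡ S (U? m ∖? z≥d?) product
      shifted = cancelʳ (trans (sym (S-split (U? m) x≥0? product)) (trans (S-split (U? m) z≥d? product)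
          (trans (cong (_+ S (U? m ∖? z≥d?) product) σ-invariant) (ℤ.+-comm (S (U? m ∖? x≥0?) product) _))))
        where
        σ-invariant : S (U? m ∩? z≥d?) product ≡ S (U? m ∖? x≥0?) product
        σ-invariant = S-bijection (U? m ∩? z≥d?) (U? m ∖? x≥0?) (λ { {v} (u , _) → U⊆box {v} u }) (λ { {v} (u , _) → U⊆box {v} u })
          σ σ⁻¹ σ⁻¹σ σσ⁻¹ (λ {v} → U-σ {v}) (λ {v} → U-σ⁻¹ {v}) product
        cancelʳ : ∀ {a b c} → a + c ≡ b + c → a ≡ b
        cancelʳ {a} {b} {c} e = trans (sym (add-sub a c)) (trans (cong (_- c) e) (add-sub b c))

    -- Adding (x - j)(y + j + 1) over the three rotations of (x , y , z), the mixed terms j x - j y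
    -- cancel and the weight remains. Rotations preserve `H`, so each of the three sums is the one
    -- evaluated by `E-sum`.
    H-recurrence : S (H? m) weight ≡ 0ℤ
    H-recurrence = begin
      S (H? m) weight
        ≡⟨ S-cong (H? m) {weight} {λ v → f v + (f (ρ v) + f (ρ (ρ v)))} (λ {v} h → expand v h) ⟩
      S (H? m) (λ v → f v + (f (ρ v) + f (ρ (ρ v))))
        ≡⟨ trans (S-+ (H? m) f _) (cong (λ s → S (H? m) f + s) (S-+ (H? m) (f ∘ ρ) (f ∘ ρ ∘ ρ))) ⟩
      S (H? m) f + (S (H? m) (f ∘ ρ) + S (H? m) (f ∘ ρ ∘ ρ))
        ≡⟨ cong₂ _+_ Sf (cong₂ _+_ (trans (rotation f) Sf) (trans (trans (rotation (f ∘ ρ)) (rotation f)) Sf)) ⟩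
      0ℤ ∎
      where
      open ≡-Reasoning
      f : V → ℤ
      f = product ∘ shear
      ρ : V → V
      ρ (j , x , y , z) = j , y , z , x
      Hρ : ∀ {v} → H m v → H m (ρ v)
      Hρ {j , x , y , z} (x≥ , y≥ , z≥ , h) = y≥ , z≥ , x≥ , trans (t x y z) h
        where
        t : ∀ x y z → y * z + z * x + x * y + (y + z + x) ≡ x * y + y * z + z * x + (x + y + z)
        t = solve-∀
      rotation : ∀ g → S (H? m) (g ∘ ρ) ≡ S (H? m) g
      rotation = S-bijection (H? m) (H? m) (λ {v} → H⊆box {v}) (λ {v} → H⊆box {v}) ρ (ρ ∘ ρ) (λ _ → refl) (λ _ → refl)
        (λ {v} → Hρ {v}) (λ {v} h → Hρ {ρ v} (Hρ {v} h))
      Sf : S (H? m) f ≡ 0ℤ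
      Sf = trans (S-bijection (H? m) (E? m) (λ {v} → H⊆box {v}) (λ {v} → E⊆box {v}) shear unshear unshear-shear shear-unshear
        (λ {v} → H⇒E {v}) (λ {v} → E⇒H {v}) product) E-sum
      expand : ∀ v → H m v → weight v ≡ f v + (f (ρ v) + f (ρ (ρ v)))
      expand (j , x , y , z) (_ , _ , _ , h) =
        trans (split m (pronic j)) (trans (cong (λ s → s + pronic j * - + 3) (sym h)) (t j x y z))
        where
        split : ∀ m j → m - j * + 4 ≡ m - j + j * - + 3
        split = solve-∀
        t : ∀ j x y z → x * y + y * z + z * x + (x + y + z) + (j * j + j) * - + 3
          ≡ (x - j) * (y + j + 1ℤ) + ((y - j) * (z + j + 1ℤ) + (z - j) * (x + j + 1ℤ))
        t = solve-∀

  -- Uniqueness for the recurrence.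

  module Vanishing (xs : List ℤ) (0∈xs : 0ℤ ∈ xs) (I : ℕ) (D : ℤ → ℤ)
    (D-origin : D 0ℤ ≡ 0ℤ) (D-negative : ∀ {n} → ¬ 0ℤ ≤ n → D n ≡ 0ℤ)
    (D-recurrence : ∀ {i} → i ℕ.≤ I →
      ∑ xs (λ j → D (+ (i ℕ.+ i) - pronic j) * (+ (i ℕ.+ i) - pronic j * + 4)) ≡ 0ℤ) where

    vanishes : ∀ i → i ℕ.≤ I → D (+ (i ℕ.+ i)) ≡ 0ℤ
    vanishes = <-rec _ step
      where
      step : ∀ i → (∀ {k} → k ℕ.< i → k ℕ.≤ I → D (+ (k ℕ.+ k)) ≡ 0ℤ) → i ℕ.≤ I → D (+ (i ℕ.+ i)) ≡ 0ℤ
      step zero      _  _   = D-origin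
      step i@(suc _) ih i≤I = conclude (ℤ.i*j≡0⇒i≡0∨j≡0 zeros isolated)
        where
        m = + (i ℕ.+ i)
        pronic≡0? : Decidable (λ j → pronic j ≡ 0ℤ)
        pronic≡0? j = pronic j ℤ.≟ 0ℤ
        zeros : ℤ
        zeros = count pronic≡0? xs
        -- For j² + j = 2 t with t > 0, the argument is the smaller even number 2 (i - t), where
        -- induction applies, or else it is negative.
        later : ∀ t → .{{ℕ.NonZero t}} → D (m - + (t ℕ.+ t)) ≡ 0ℤ
        later t with t ℕ.≤? i
        ... | yes t≤i = trans (cong D (trans (r (+ i) (+ t)) (cong (λ k → k + k) i-t≡)))
                              (ih (ℕ.∸-monoʳ-< (ℕ.>-nonZero⁻¹ t) t≤i) (ℕ.≤-trans (ℕ.m∸n≤m i t) i≤I))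
          where
          r : ∀ i t → i + i - (t + t) ≡ i - t + (i - t)
          r = solve-∀
          i-t≡ : + i - + t ≡ + (i ℕ.∸ t)
          i-t≡ = trans (ℤ.m-n≡m⊖n i t) (ℤ.⊖-≥ t≤i)
        ... | no t≰i  = D-negative (λ h → t≰i (ℕ.≮⇒≥ (λ i<t → ℤ.≤⇒≯ (ℤ.0≤i-j⇒j≤i h) (ℤ.+<+ (ℕ.+-mono-< i<t i<t)))))
        term : ∀ j → D (m - pronic j) * (m - pronic j * + 4) ≡ gate (pronic≡0? j) 1ℤ * (D m * m)
        term j with pronic≡0? j
        ... | yes e = trans (cong (λ s → D (m - s) * (m - s * + 4)) e)
                        (trans (cong (λ s → D s * s) (ℤ.+-identityʳ m)) (sym (ℤ.*-identityˡ (D m * m))))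
        ... | no ¬e = trans (cong (_* (m - pronic j * + 4)) (trans (cong (λ s → D (m - s)) (pronic≡ j)) (later t {{ℕ.≢-nonZero t≢0}})))
                        (trans (ℤ.*-zeroˡ (m - pronic j * + 4)) (sym (ℤ.*-zeroˡ (D m * m))))
          where
          t = triangle (index j)
          t≢0 : ¬ t ≡ 0
          t≢0 t≡0 = ¬e (trans (pronic≡ j) (cong (λ s → + (s ℕ.+ s)) t≡0))
        -- The terms with j² + j > 0 vanish by induction; those with j² + j = 0 carry the coefficient m ≠ 0.
        isolated : zeros * (D m * m) ≡ 0ℤ
        isolated = trans (sym (trans (∑-cong xs term) (∑-*ʳ xs _ (D m * m)))) (D-recurrence i≤I)
        zeros≢0 : ¬ zeros ≡ 0ℤ
        zeros≢0 e with +≤+ () ← subst (1ℤ ≤_) e (count-pos pronic≡0? 0∈xs refl)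
        conclude : zeros ≡ 0ℤ ⊎ D m * m ≡ 0ℤ → D m ≡ 0ℤ
        conclude (inj₁ z) = ⊥-elim (zeros≢0 z)
        -- The other alternative, m = 0, is impossible because `i` is a successor here.
        conclude (inj₂ z) with inj₁ d ← ℤ.i*j≡0⇒i≡0∨j≡0 (D m) z = d

  -- Proportionality of the two counts.

  module Counting (I : ℕ) where

    -- The bound m + m + 4 for the largest value m = 2 I. A single box serves all i ≤ I, so the
    -- recurrences for different i concern the same counting functions.
    L : ℕ
    L = I ℕ.+ I ℕ.+ (I ℕ.+ I) ℕ.+ 4

    open Box L

    fits : ∀ {i} → i ℕ.≤ I → 0ℤ ≤ + L - (+ (i ℕ.+ i) + + (i ℕ.+ i) + + 4)
    fits i≤I = ℤ.i≤j⇒0≤j-i (+≤+ (ℕ.+-monoˡ-≤ 4 (ℕ.+-mono-≤ (ℕ.+-mono-≤ i≤I i≤I) (ℕ.+-mono-≤ i≤I i≤I))))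

    -- D = 0 states the proportionality of #F and #H without computing #F 0 = 8 and #H 0 = 1.
    #F #H D : ℤ → ℤ
    #F n = count (F₃? n) box₃
    #H n = count (H₃? n) box₃
    D n  = #F n * #H 0ℤ - #H n * #F 0ℤ

    -- The weight depends on j alone, so grouping the solutions by j turns their weighted sum into a
    -- weighted sum of counts.
    slice : ∀ {G : ℤ → V₃ → Set} (G? : ∀ n → Decidable (G n)) m →
      ∑ box (λ (j , t) → gate (G? (m - pronic j) t) (m - pronic j * + 4))
        ≡ ∑ interval (λ j → count (G? (m - pronic j)) box₃ * (m - pronic j * + 4))
    slice G? m = trans (∑-cartesianProduct interval box₃ _) (∑-cong interval (λ j →
      trans (∑-cong box₃ (λ t → gate-* (G? (m - pronic j) t) (m - pronic j * + 4))) (∑-*ʳ box₃ _ (m - pronic j * + 4))))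

    D-recurrence : ∀ {i} → i ℕ.≤ I → let m = + (i ℕ.+ i) in
      ∑ interval (λ j → D (m - pronic j) * (m - pronic j * + 4)) ≡ 0ℤ
    D-recurrence {i} i≤I = begin
      ∑ interval (λ j → D (m - pronic j) * (m - pronic j * + 4))
        ≡⟨ ∑-cong interval (λ j → t (#F (m - pronic j)) (#H 0ℤ) (#H (m - pronic j)) (#F 0ℤ) (m - pronic j * + 4)) ⟩
      ∑ interval (λ j → f j * #H 0ℤ + h j * - #F 0ℤ)
        ≡⟨ trans (∑-+ interval _ _) (cong₂ _+_ (∑-*ʳ interval f (#H 0ℤ)) (∑-*ʳ interval h (- #F 0ℤ))) ⟩
      ∑ interval f * #H 0ℤ + ∑ interval h * - #F 0ℤ
        ≡⟨ cong₂ (λ a b → a * #H 0ℤ + b * - #F 0ℤ)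
             (trans (sym (slice F₃? m)) (Recurrences.F-recurrence L m (+ i) refl (+≥0 _) (fits i≤I)))
             (trans (sym (slice H₃? m)) (Recurrences.H-recurrence L m (+ i) refl (+≥0 _) (fits i≤I))) ⟩
      0ℤ * #H 0ℤ + 0ℤ * - #F 0ℤ
        ≡⟨ cong₂ _+_ (ℤ.*-zeroˡ (#H 0ℤ)) (ℤ.*-zeroˡ (- #F 0ℤ)) ⟩
      0ℤ ∎
      where
      open ≡-Reasoning
      m = + (i ℕ.+ i)
      f h : ℤ → ℤ
      f j = #F (m - pronic j) * (m - pronic j * + 4)
      h j = #H (m - pronic j) * (m - pronic j * + 4)
      t : ∀ a b c d w → (a * b - c * d) * w ≡ a * w * b + c * w * - d
      t = solve-∀

    F₃-nonneg : ∀ {n} t → F₃ n t → 0ℤ ≤ n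
    F₃-nonneg (a , b , c) refl = pronic-nonneg a ⊕ pronic-nonneg b ⊕ pronic-nonneg c

    H₃-nonneg : ∀ {n} t → H₃ n t → 0ℤ ≤ n
    H₃-nonneg (x , y , z) (x≥ , y≥ , z≥ , refl) = x≥ ⊗ y≥ ⊕ y≥ ⊗ z≥ ⊕ z≥ ⊗ x≥ ⊕ (x≥ ⊕ y≥ ⊕ z≥)

    D-negative : ∀ {n} → ¬ 0ℤ ≤ n → D n ≡ 0ℤ
    D-negative {n} n<0 = cong₂ (λ f h → f * #H 0ℤ - h * #F 0ℤ)
      (count-zero (F₃? n) box₃ (λ t Ft → n<0 (F₃-nonneg t Ft)))
      (count-zero (H₃? n) box₃ (λ t Ht → n<0 (H₃-nonneg t Ht)))

    0∈interval : 0ℤ ∈ interval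
    0∈interval = ∈-interval L+0≥0 L+0≥0
      where
      L+0≥0 : 0ℤ ≤ + L + 0ℤ
      L+0≥0 = +≥0 L via sym (ℤ.+-identityʳ (+ L))

    D-origin : D 0ℤ ≡ 0ℤ
    D-origin = trans (cong (λ s → s - #H 0ℤ * #F 0ℤ) (ℤ.*-comm (#F 0ℤ) (#H 0ℤ))) (ℤ.+-inverseʳ (#H 0ℤ * #F 0ℤ))

    D-zero : D (+ (I ℕ.+ I)) ≡ 0ℤ
    D-zero = Vanishing.vanishes interval 0∈interval I D D-origin D-negative D-recurrence I ℕ.≤-refl

    #H-pos : 1ℤ ≤ #H (+ (I ℕ.+ I))
    #H-pos = count-pos (H₃? _) {0ℤ , 0ℤ , + (I ℕ.+ I)}
      (∈-cartesianProduct⁺ 0∈interval (∈-cartesianProduct⁺ 0∈interval (∈-interval (ℤ.i≤j⇒0≤j-i (+≤+ 2I≤L)) (+≥0 _))))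
      (ℤ.≤-refl , ℤ.≤-refl , +≥0 _ , t (+ I))
      where
      t : ∀ k → 0ℤ * 0ℤ + 0ℤ * (k + k) + (k + k) * 0ℤ + (0ℤ + 0ℤ + (k + k)) ≡ k + k
      t = solve-∀
      2I≤L : I ℕ.+ I ℕ.≤ L
      2I≤L = ℕ.≤-trans (ℕ.m≤m+n (I ℕ.+ I) (I ℕ.+ I)) (ℕ.m≤m+n _ 4)

    #F0-pos : 1ℤ ≤ #F 0ℤ
    #F0-pos = count-pos (F₃? 0ℤ) {0ℤ , 0ℤ , 0ℤ} (∈-cartesianProduct⁺ 0∈interval (∈-cartesianProduct⁺ 0∈interval 0∈interval)) refl

    -- If this count were 0, `D-zero` would make the product of `#H (+ (I ℕ.+ I))` and `#F 0ℤ`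
    -- vanish, but both are positive.
    #F-pos : 1ℤ ≤ #F (+ (I ℕ.+ I))
    #F-pos = go (#F (+ (I ℕ.+ I))) (count-nonneg (F₃? _) box₃) refl
      where
      product-pos : ∀ {a b} → 1ℤ ≤ a → 1ℤ ≤ b → ¬ a * b ≡ 0ℤ
      product-pos {+ suc a} {+ suc b} _ _ ()
      product-pos {+ zero} (+≤+ ())
      product-pos {+ suc a} {+ zero} _ (+≤+ ())
      go : ∀ n → 0ℤ ≤ n → #F (+ (I ℕ.+ I)) ≡ n → 1ℤ ≤ n
      go (+ suc n) _ _ = +≤+ (ℕ.s≤s ℕ.z≤n)
      go (+ zero)  _ e = ⊥-elim (product-pos #H-pos #F0-pos (sym (trans (sym (ℤ.*-zeroˡ (#H 0ℤ)))
        (trans (cong (_* #H 0ℤ) (sym e)) (ℤ.i-j≡0⇒i≡j _ _ D-zero)))))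

  three-triangular : ∀ i → ∃ λ (t : V₃) → F₃ (+ (i ℕ.+ i)) t
  three-triangular i = count-witness (F₃? _) (Box.box₃ (Counting.L i)) (Counting.#F-pos i)

-- Positive rationals with product 1: existence and the lower bound.

module RationalSums where

  open ThreeTriangular using (pronic; F₃; three-triangular)
  open import Data.Integer using (ℤ; +_)
  open import Data.Rational
  open import Data.Rational.Properties
  open import Data.Rational.Solver using (module +-*-Solver)
  open +-*-Solver

  2ℚ 4ℚ 5ℚ 8ℚ : ℚ
  2ℚ = + 2 / 1
  4ℚ = + 4 / 1
  5ℚ = + 5 / 1
  8ℚ = + 8 / 1

  ℤ→ℚ : ℤ → ℚ
  ℤ→ℚ i = i / 1

  -- As unnormalised fractions both sides have denominator 1, which leaves an identity between
  -- numerators.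
  ℤ→ℚ-+ : ∀ i j → ℤ→ℚ (i ℤ.+ j) ≡ ℤ→ℚ i + ℤ→ℚ j
  ℤ→ℚ-+ i j = toℚᵘ-injective (begin
    toℚᵘ (ℤ→ℚ (i ℤ.+ j))               ≈⟨ toℚᵘ-fromℚᵘ (ℚᵘ.mkℚᵘ (i ℤ.+ j) 0) ⟩
    ℚᵘ.mkℚᵘ (i ℤ.+ j) 0                ≈⟨ ℚᵘ.*≡* (cong (ℤ._* + 1) (cong₂ ℤ._+_ (sym (ℤ.*-identityʳ i)) (sym (ℤ.*-identityʳ j)))) ⟩
    ℚᵘ.mkℚᵘ i 0 ℚᵘ.+ ℚᵘ.mkℚᵘ j 0       ≈⟨ ℚᵘ.+-cong (toℚᵘ-fromℚᵘ (ℚᵘ.mkℚᵘ i 0)) (toℚᵘ-fromℚᵘ (ℚᵘ.mkℚᵘ j 0)) ⟨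
    toℚᵘ (ℤ→ℚ i) ℚᵘ.+ toℚᵘ (ℤ→ℚ j)     ≈⟨ toℚᵘ-homo-+ (ℤ→ℚ i) (ℤ→ℚ j) ⟨
    toℚᵘ (ℤ→ℚ i + ℤ→ℚ j)               ∎)
    where open ℚᵘ.≃-Reasoning

  ℤ→ℚ-* : ∀ i j → ℤ→ℚ (i ℤ.* j) ≡ ℤ→ℚ i * ℤ→ℚ j
  ℤ→ℚ-* i j = toℚᵘ-injective (begin
    toℚᵘ (ℤ→ℚ (i ℤ.* j))               ≈⟨ toℚᵘ-fromℚᵘ (ℚᵘ.mkℚᵘ (i ℤ.* j) 0) ⟩
    ℚᵘ.mkℚᵘ i 0 ℚᵘ.* ℚᵘ.mkℚᵘ j 0       ≈⟨ ℚᵘ.*-cong (toℚᵘ-fromℚᵘ (ℚᵘ.mkℚᵘ i 0)) (toℚᵘ-fromℚᵘ (ℚᵘ.mkℚᵘ j 0)) ⟨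
    toℚᵘ (ℤ→ℚ i) ℚᵘ.* toℚᵘ (ℤ→ℚ j)     ≈⟨ toℚᵘ-homo-* (ℤ→ℚ i) (ℤ→ℚ j) ⟨
    toℚᵘ (ℤ→ℚ i * ℤ→ℚ j)               ∎)
    where open ℚᵘ.≃-Reasoning

  infixl 6 _⊕_
  infixl 7 _⊗_

  _⊕_ : ∀ {p q} → 0ℚ < p → 0ℚ ≤ q → 0ℚ < p + q
  _⊕_ = +-mono-<-≤

  _⊗_ : ∀ {p q} → 0ℚ < p → 0ℚ < q → 0ℚ < p * q
  _⊗_ {p} {q} p>0 q>0 = positive⁻¹ (p * q) {{pos*pos⇒pos p {{positive p>0}} q {{positive q>0}}}}

  square-nonneg : ∀ p → 0ℚ ≤ p * p
  square-nonneg p with ≤-total 0ℚ p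
  ... | inj₁ p≥0 = nonNegative⁻¹ (p * p) {{nonNeg*nonNeg⇒nonNeg p {{nonNegative p≥0}} p {{nonNegative p≥0}}}}
  ... | inj₂ p≤0 = subst (0ℚ ≤_) (solve 1 (λ p → (:- p) :* (:- p) := p :* p) refl p)
        (nonNegative⁻¹ (- p * - p) {{nonNeg*nonNeg⇒nonNeg (- p) {{nonNegative (neg-antimono-≤ p≤0)}} (- p) {{nonNegative (neg-antimono-≤ p≤0)}}}})

  inverse : ∀ {p} → 0ℚ < p → ∃ λ r → 0ℚ < r × p * r ≡ 1ℚ
  inverse {p} p>0 = (1/ p) , positive⁻¹ (1/ p) {{1/pos⇒pos p}} , *-inverseʳ p
    where instance
    p-pos : Positive p
    p-pos = positive p>0
    p≢0 : NonZero p
    p≢0 = pos⇒nonZero p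

  -- `InA n s` is the case of product 1 and sum s. Arbitrary products are allowed because a scaled
  -- triple has product c³, and only the three scales together restore 1.
  Realised : ℕ → ℚ → ℚ → Set
  Realised n π σ = Σ (Fin n → ℚ) λ a → ((i : Fin n) → 0ℚ < a i) × prodℚ a ≡ π × sumℚ a ≡ σ

  empty : Realised 0 1ℚ 0ℚ
  empty = (λ ()) , (λ ()) , refl , refl

  cons : ∀ {n π σ} x → 0ℚ < x → Realised n π σ → Realised (suc n) (x * π) (x + σ)
  cons x x>0 (a , a>0 , refl , refl) = x Vec.∷ a , (λ { zero → x>0 ; (suc i) → a>0 i }) , refl , refl

  one : ∀ {n π σ} → Realised n π σ → Realised (suc n) π (1ℚ + σ)
  one {n} {π} {σ} r = subst (λ π′ → Realised (suc n) π′ (1ℚ + σ)) (*-identityˡ π) (cons 1ℚ (positive⁻¹ 1ℚ) r)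

  module _ (c b w b⁻¹ w⁻¹ s : ℚ) (bb⁻¹≡1 : b * b⁻¹ ≡ 1ℚ) (ww⁻¹≡1 : w * w⁻¹ ≡ 1ℚ)
    (cubes : b * b * b + w * w * w + 8ℚ ≡ 2ℚ * (b * w * s)) where

    open ≡-Reasoning

    -- Over the common denominator 2 b w the numerators are b³, w³ and 8, and `cubes` evaluates
    -- their sum. To the ring solver the inverses are mere variables, so b b⁻¹ and w w⁻¹ are
    -- inserted and removed by hand.
    triple-sum : ∀ σ → c * (½ * (b * b * w⁻¹)) + (c * (½ * (w * w * b⁻¹)) + (c * (4ℚ * (b⁻¹ * w⁻¹)) + σ)) ≡ c * s + σ
    triple-sum σ = begin
      c * (½ * (b * b * w⁻¹)) + (c * (½ * (w * w * b⁻¹)) + (c * (4ℚ * (b⁻¹ * w⁻¹)) + σ))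
        ≡⟨ solve 6 (λ c b w b′ w′ σ →
             c :* (con ½ :* (b :* b :* w′)) :+ (c :* (con ½ :* (w :* w :* b′)) :+ (c :* (con 4ℚ :* (b′ :* w′)) :+ σ)) :=
             c :* con ½ :* (b :* b :* w′ :* con 1ℚ :+ w :* w :* b′ :* con 1ℚ :+ con 8ℚ :* (b′ :* w′)) :+ σ) refl c b w b⁻¹ w⁻¹ σ ⟩
      c * ½ * (b * b * w⁻¹ * 1ℚ + w * w * b⁻¹ * 1ℚ + 8ℚ * (b⁻¹ * w⁻¹)) + σ
        ≡⟨ cong₂ (λ x y → c * ½ * (b * b * w⁻¹ * x + w * w * b⁻¹ * y + 8ℚ * (b⁻¹ * w⁻¹)) + σ) (sym bb⁻¹≡1) (sym ww⁻¹≡1) ⟩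
      c * ½ * (b * b * w⁻¹ * (b * b⁻¹) + w * w * b⁻¹ * (w * w⁻¹) + 8ℚ * (b⁻¹ * w⁻¹)) + σ
        ≡⟨ solve 6 (λ c b w b′ w′ σ →
             c :* con ½ :* (b :* b :* w′ :* (b :* b′) :+ w :* w :* b′ :* (w :* w′) :+ con 8ℚ :* (b′ :* w′)) :+ σ :=
             c :* con ½ :* ((b :* b :* b :+ w :* w :* w :+ con 8ℚ) :* (b′ :* w′)) :+ σ) refl c b w b⁻¹ w⁻¹ σ ⟩
      c * ½ * ((b * b * b + w * w * w + 8ℚ) * (b⁻¹ * w⁻¹)) + σ
        ≡⟨ cong (λ x → c * ½ * (x * (b⁻¹ * w⁻¹)) + σ) cubes ⟩
      c * ½ * (2ℚ * (b * w * s) * (b⁻¹ * w⁻¹)) + σ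
        ≡⟨ solve 7 (λ c b w b′ w′ s σ →
             c :* con ½ :* (con 2ℚ :* (b :* w :* s) :* (b′ :* w′)) :+ σ := c :* s :* ((b :* b′) :* (w :* w′)) :+ σ) refl c b w b⁻¹ w⁻¹ s σ ⟩
      c * s * ((b * b⁻¹) * (w * w⁻¹)) + σ
        ≡⟨ cong₂ (λ x y → c * s * (x * y) + σ) bb⁻¹≡1 ww⁻¹≡1 ⟩
      c * s * (1ℚ * 1ℚ) + σ
        ≡⟨ cong (_+ σ) (*-identityʳ (c * s)) ⟩
      c * s + σ ∎

    triple-product : ∀ π → c * (½ * (b * b * w⁻¹)) * (c * (½ * (w * w * b⁻¹)) * (c * (4ℚ * (b⁻¹ * w⁻¹)) * π)) ≡ c * c * c * π
    triple-product π = begin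
      c * (½ * (b * b * w⁻¹)) * (c * (½ * (w * w * b⁻¹)) * (c * (4ℚ * (b⁻¹ * w⁻¹)) * π))
        ≡⟨ solve 6 (λ c b w b′ w′ π →
             c :* (con ½ :* (b :* b :* w′)) :* (c :* (con ½ :* (w :* w :* b′)) :* (c :* (con 4ℚ :* (b′ :* w′)) :* π)) :=
             c :* c :* c :* π :* ((b :* b′) :* (b :* b′) :* ((w :* w′) :* (w :* w′)))) refl c b w b⁻¹ w⁻¹ π ⟩
      c * c * c * π * ((b * b⁻¹) * (b * b⁻¹) * ((w * w⁻¹) * (w * w⁻¹)))
        ≡⟨ cong₂ (λ x y → c * c * c * π * (x * x * (y * y))) bb⁻¹≡1 ww⁻¹≡1 ⟩
      c * c * c * π * (1ℚ * 1ℚ * (1ℚ * 1ℚ))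
        ≡⟨ *-identityʳ (c * c * c * π) ⟩
      c * c * c * π ∎

  triple : ∀ {n π σ} c → 0ℚ < c → ∀ v → Realised n π σ →
    Realised (suc (suc (suc n))) (c * c * c * π) (c * (v * v + 5ℚ) + σ)
  triple {n} {π} {σ} c c>0 v r = from-inverses (inverse b>0) (inverse w>0)
    where
    b w : ℚ
    b = v * v - v + 1ℚ
    w = v * v + v + 1ℚ
    -- Completing the square, v² ∓ v + 1 = 3/4 + (v ∓ 1/2)², so b and w are positive for v of any
    -- sign.
    ¾>0 : 0ℚ < + 3 / 4
    ¾>0 = positive⁻¹ (+ 3 / 4)
    b>0 : 0ℚ < b
    b>0 = subst (0ℚ <_) (solve 1 (λ v → con (+ 3 / 4) :+ (v :- con ½) :* (v :- con ½) := v :* v :- v :+ con 1ℚ) refl v)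
      (¾>0 ⊕ square-nonneg (v - ½))
    w>0 : 0ℚ < w
    w>0 = subst (0ℚ <_) (solve 1 (λ v → con (+ 3 / 4) :+ (v :+ con ½) :* (v :+ con ½) := v :* v :+ v :+ con 1ℚ) refl v)
      (¾>0 ⊕ square-nonneg (v + ½))
    cubes : b * b * b + w * w * w + 8ℚ ≡ 2ℚ * (b * w * (v * v + 5ℚ))
    cubes = solve 1 (λ v → let b = v :* v :- v :+ con 1ℚ; w = v :* v :+ v :+ con 1ℚ in
      b :* b :* b :+ w :* w :* w :+ con 8ℚ := con 2ℚ :* (b :* w :* (v :* v :+ con 5ℚ))) refl v
    ½>0 : 0ℚ < ½
    ½>0 = positive⁻¹ ½
    4>0 : 0ℚ < 4ℚ
    4>0 = positive⁻¹ 4ℚ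
    from-inverses : (∃ λ b⁻¹ → 0ℚ < b⁻¹ × b * b⁻¹ ≡ 1ℚ) → (∃ λ w⁻¹ → 0ℚ < w⁻¹ × w * w⁻¹ ≡ 1ℚ) →
      Realised (suc (suc (suc n))) (c * c * c * π) (c * (v * v + 5ℚ) + σ)
    from-inverses (b⁻¹ , b⁻¹>0 , bb⁻¹≡1) (w⁻¹ , w⁻¹>0 , ww⁻¹≡1) =
      subst₂ (Realised (suc (suc (suc n))))
        (triple-product c b w b⁻¹ w⁻¹ (v * v + 5ℚ) bb⁻¹≡1 ww⁻¹≡1 cubes π)
        (triple-sum c b w b⁻¹ w⁻¹ (v * v + 5ℚ) bb⁻¹≡1 ww⁻¹≡1 cubes σ)
        (cons (c * (½ * (b * b * w⁻¹))) (c>0 ⊗ (½>0 ⊗ (b>0 ⊗ b>0 ⊗ w⁻¹>0)))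
        (cons (c * (½ * (w * w * b⁻¹))) (c>0 ⊗ (½>0 ⊗ (w>0 ⊗ w>0 ⊗ b⁻¹>0)))
        (cons (c * (4ℚ * (b⁻¹ * w⁻¹))) (c>0 ⊗ (4>0 ⊗ (b⁻¹>0 ⊗ w⁻¹>0))) r)))

  abstract
    subst-sum : ∀ {n π σ σ′} → σ ≡ σ′ → Realised n π σ → Realised n π σ′
    subst-sum refl r = r

  ℤ→ℚ-pronic : ∀ a → ℤ→ℚ (pronic a) ≡ ℤ→ℚ a * ℤ→ℚ a + ℤ→ℚ a
  ℤ→ℚ-pronic a = trans (ℤ→ℚ-+ (a ℤ.* a) a) (cong (_+ ℤ→ℚ a) (ℤ→ℚ-* a a))

  -- The scales 16/9, 9/16, 1 have product 1, and 5 (16/9 + 9/16 + 1) = 2405/144 where 2405 ≡ 5 (mod 8).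
  c₁ c₂ : ℚ
  c₁ = + 16 / 9
  c₂ = + 9 / 16

  -- For s = 17 + k, 144 s - 2405 = 8 (18 k + 5) + 3.
  nine-large : ∀ k → Realised 9 1ℚ (ℤ→ℚ (+ (17 ℕ.+ k)))
  nine-large k = from-triangular (three-triangular (18 ℕ.* k ℕ.+ 5))
    where
    open ≡-Reasoning
    κ : ℚ
    κ = ℤ→ℚ (+ k)
    i : ℕ
    i = 18 ℕ.* k ℕ.+ 5
    ℤ→ℚ-i : ℤ→ℚ (+ i) ≡ ℤ→ℚ (+ 18) * κ + 5ℚ
    ℤ→ℚ-i = trans (ℤ→ℚ-+ (+ (18 ℕ.* k)) (+ 5)) (cong (_+ 5ℚ) (trans (cong ℤ→ℚ (ℤ.pos-* 18 k)) (ℤ→ℚ-* (+ 18) (+ k))))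
    module _ (a b c : ℤ) (h : F₃ (+ (i ℕ.+ i)) (a , b , c)) where
      α β γ : ℚ
      α = ℤ→ℚ a
      β = ℤ→ℚ b
      γ = ℤ→ℚ c
      pronics : α * α + α + (β * β + β) + (γ * γ + γ) ≡ (ℤ→ℚ (+ 18) * κ + 5ℚ) + (ℤ→ℚ (+ 18) * κ + 5ℚ)
      pronics = begin
        α * α + α + (β * β + β) + (γ * γ + γ)
          ≡⟨ cong₂ _+_ (cong₂ _+_ (ℤ→ℚ-pronic a) (ℤ→ℚ-pronic b)) (ℤ→ℚ-pronic c) ⟨
        ℤ→ℚ (pronic a) + ℤ→ℚ (pronic b) + ℤ→ℚ (pronic c)
          ≡⟨ trans (ℤ→ℚ-+ (pronic a ℤ.+ pronic b) (pronic c)) (cong (_+ ℤ→ℚ (pronic c)) (ℤ→ℚ-+ (pronic a) (pronic b))) ⟨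
        ℤ→ℚ (pronic a ℤ.+ pronic b ℤ.+ pronic c)
          ≡⟨ cong ℤ→ℚ h ⟩
        ℤ→ℚ (+ i ℤ.+ + i)
          ≡⟨ trans (ℤ→ℚ-+ (+ i) (+ i)) (cong₂ _+_ ℤ→ℚ-i ℤ→ℚ-i) ⟩
        (ℤ→ℚ (+ 18) * κ + 5ℚ) + (ℤ→ℚ (+ 18) * κ + 5ℚ) ∎
      -- The denominators 16, 9 and 12 make each scale times v² equal to an odd square over 144:
      -- (16/9)/16² = (9/16)/9² = 1/12² = 1/144.
      v₁ v₂ v₃ : ℚ
      v₁ = (2ℚ * α + 1ℚ) * (+ 1 / 16)
      v₂ = (2ℚ * β + 1ℚ) * (+ 1 / 9)
      v₃ = (2ℚ * γ + 1ℚ) * (+ 1 / 12)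
      total : c₁ * (v₁ * v₁ + 5ℚ) + (c₂ * (v₂ * v₂ + 5ℚ) + (1ℚ * (v₃ * v₃ + 5ℚ) + 0ℚ)) ≡ ℤ→ℚ (+ (17 ℕ.+ k))
      total = begin
        c₁ * (v₁ * v₁ + 5ℚ) + (c₂ * (v₂ * v₂ + 5ℚ) + (1ℚ * (v₃ * v₃ + 5ℚ) + 0ℚ))
          ≡⟨ solve 3 (λ α β γ →
               let v₁ = (con 2ℚ :* α :+ con 1ℚ) :* con (+ 1 / 16)
                   v₂ = (con 2ℚ :* β :+ con 1ℚ) :* con (+ 1 / 9)
                   v₃ = (con 2ℚ :* γ :+ con 1ℚ) :* con (+ 1 / 12) in
               con c₁ :* (v₁ :* v₁ :+ con 5ℚ) :+ (con c₂ :* (v₂ :* v₂ :+ con 5ℚ) :+ (con 1ℚ :* (v₃ :* v₃ :+ con 5ℚ) :+ con 0ℚ)) :=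
               con (+ 1 / 36) :* (α :* α :+ α :+ (β :* β :+ β) :+ (γ :* γ :+ γ)) :+ con (+ 301 / 18)) refl α β γ ⟩
        -- Since (2 a + 1)² = 4 (a² + a) + 1, the factor is 4/144, and the constant is (2405 +
        -- 3)/144 with a 1 from each odd square.
        + 1 / 36 * (α * α + α + (β * β + β) + (γ * γ + γ)) + + 301 / 18
          ≡⟨ cong (λ x → + 1 / 36 * x + + 301 / 18) pronics ⟩
        + 1 / 36 * ((ℤ→ℚ (+ 18) * κ + 5ℚ) + (ℤ→ℚ (+ 18) * κ + 5ℚ)) + + 301 / 18
          ≡⟨ solve 1 (λ κ → con (+ 1 / 36) :* ((con (+ 18 / 1) :* κ :+ con 5ℚ) :+ (con (+ 18 / 1) :* κ :+ con 5ℚ)) :+ con (+ 301 / 18)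
               := con (+ 17 / 1) :+ κ) refl κ ⟩
        ℤ→ℚ (+ 17) + κ
          ≡⟨ ℤ→ℚ-+ (+ 17) (+ k) ⟨
        ℤ→ℚ (+ (17 ℕ.+ k)) ∎
    from-triangular : ∃ (F₃ (+ (i ℕ.+ i))) → Realised 9 1ℚ (ℤ→ℚ (+ (17 ℕ.+ k)))
    from-triangular ((a , b , c) , h) = subst-sum (total a b c h)
      (triple c₁ (positive⁻¹ c₁) (v₁ a b c h) (triple c₂ (positive⁻¹ c₂) (v₂ a b c h)
        (triple 1ℚ (positive⁻¹ 1ℚ) (v₃ a b c h) empty)))

  -- Small sums, and padding by ones.

  ones : ∀ n → Realised n 1ℚ (ℤ→ℚ (+ n))
  ones zero    = empty
  ones (suc n) = subst-sum (sym (ℤ→ℚ-+ (+ 1) (+ n))) (one (ones n))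

  unit-triple : ∀ {n σ} v → Realised n 1ℚ σ → Realised (3 ℕ.+ n) 1ℚ (v * v + 5ℚ + σ)
  unit-triple {n} {σ} v r =
    subst-sum (cong (_+ σ) (*-identityˡ (v * v + 5ℚ))) (triple 1ℚ (positive⁻¹ 1ℚ) v r)

  five : ∀ {n} m → Realised n 1ℚ (ℤ→ℚ (+ m)) → Realised (3 ℕ.+ n) 1ℚ (ℤ→ℚ (+ (5 ℕ.+ m)))
  five m r = subst-sum (sym (ℤ→ℚ-+ (+ 5) (+ m))) (unit-triple 0ℚ r)

  six : ∀ {n} m → Realised n 1ℚ (ℤ→ℚ (+ m)) → Realised (3 ℕ.+ n) 1ℚ (ℤ→ℚ (+ (6 ℕ.+ m)))
  six m r = subst-sum (sym (ℤ→ℚ-+ (+ 6) (+ m))) (unit-triple 1ℚ r)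

  -- The integral unit triples exceed the sum of as many ones by 2 and 3; these four numbers supply
  -- the excess 1.
  five-from-four : ∀ {n} m → Realised n 1ℚ (ℤ→ℚ (+ m)) → Realised (4 ℕ.+ n) 1ℚ (ℤ→ℚ (+ (5 ℕ.+ m)))
  five-from-four m r = subst-sum (trans (collect (ℤ→ℚ (+ m))) (sym (ℤ→ℚ-+ (+ 5) (+ m))))
    (cons 2ℚ (positive⁻¹ 2ℚ) (cons 2ℚ (positive⁻¹ 2ℚ) (cons ½ (positive⁻¹ ½) (cons ½ (positive⁻¹ ½) r))))
    where
    collect : ∀ σ → 2ℚ + (2ℚ + (½ + (½ + σ))) ≡ 5ℚ + σ
    collect = solve 1 (λ σ → con 2ℚ :+ (con 2ℚ :+ (con ½ :+ (con ½ :+ σ))) := con 5ℚ :+ σ) refl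

  -- Here k is the excess over nine ones. For k = 2, ..., 7 it is a sum of at most three excesses 2
  -- or 3, and nine places hold three triples.
  nine : ∀ k → Realised 9 1ℚ (ℤ→ℚ (+ (9 ℕ.+ k)))
  nine 0 = ones 9
  nine 1 = five-from-four 5 (ones 5)
  nine 2 = five 6 (ones 6)
  nine 3 = six 6 (ones 6)
  nine 4 = five 8 (five 3 (ones 3))
  nine 5 = five 9 (six 3 (ones 3))
  nine 6 = five 10 (five 5 (five 0 (ones 0)))
  nine 7 = five 11 (five 6 (six 0 (ones 0)))
  nine (suc (suc (suc (suc (suc (suc (suc (suc k)))))))) = nine-large k

  padded : ∀ d {s} → InA 9 s → InA (d ℕ.+ 9) (d ℕ.+ s)
  padded zero    r = r
  padded (suc d) {s} r = subst-sum (sym (ℤ→ℚ-+ (+ 1) (+ (d ℕ.+ s)))) (one (padded d r))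

  realised : ∀ {n s} → 9 ℕ.≤ n → n ℕ.≤ s → InA n s
  realised {n} {s} 9≤n n≤s = subst₂ InA (ℕ.m∸n+n≡m 9≤n) s≡ (padded (n ℕ.∸ 9) (nine (s ℕ.∸ n)))
    where
    s≡ : n ℕ.∸ 9 ℕ.+ (9 ℕ.+ (s ℕ.∸ n)) ≡ s
    s≡ = trans (sym (ℕ.+-assoc (n ℕ.∸ 9) 9 (s ℕ.∸ n))) (trans (cong (ℕ._+ (s ℕ.∸ n)) (ℕ.m∸n+n≡m 9≤n)) (ℕ.m+[n∸m]≡n n≤s))

  -- The inequality of arithmetic and geometric means.

  infixr 8 _^_
  _^_ : ℚ → ℕ → ℚ
  x ^ zero  = 1ℚ
  x ^ suc n = x * x ^ n

  *-monoʳ : ∀ {r p q} → 0ℚ ≤ r → p ≤ q → r * p ≤ r * q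
  *-monoʳ {r} r≥0 p≤q = *-monoˡ-≤-nonNeg r {{nonNegative r≥0}} p≤q

  *-nonneg : ∀ {p q} → 0ℚ ≤ p → 0ℚ ≤ q → 0ℚ ≤ p * q
  *-nonneg {p} {q} p≥0 q≥0 = subst (_≤ p * q) (*-zeroʳ p) (*-monoʳ p≥0 q≥0)

  ^-nonneg : ∀ {x} n → 0ℚ ≤ x → 0ℚ ≤ x ^ n
  ^-nonneg zero    _   = nonNegative⁻¹ 1ℚ
  ^-nonneg (suc n) x≥0 = *-nonneg x≥0 (^-nonneg n x≥0)

  ℕ→ℚ-nonneg : ∀ n → 0ℚ ≤ ℕ→ℚ n
  ℕ→ℚ-nonneg zero    = ≤-refl
  ℕ→ℚ-nonneg (suc n) = subst (0ℚ ≤_) (sym (ℤ→ℚ-+ (+ 1) (+ n))) (+-mono-≤ (nonNegative⁻¹ 1ℚ) (ℕ→ℚ-nonneg n))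

  ℕ→ℚ-suc : ∀ n → ℕ→ℚ (suc n) ≡ 1ℚ + ℕ→ℚ n
  ℕ→ℚ-suc n = ℤ→ℚ-+ (+ 1) (+ n)

  ℕ→ℚ-pos : ∀ n → 0ℚ < ℕ→ℚ (suc n)
  ℕ→ℚ-pos n = subst (0ℚ <_) (sym (ℕ→ℚ-suc n)) (positive⁻¹ 1ℚ ⊕ ℕ→ℚ-nonneg n)

  x≤x+y : ∀ x {y} → 0ℚ ≤ y → x ≤ x + y
  x≤x+y x {y} y≥0 = subst (_≤ x + y) (+-identityʳ x) (+-monoʳ-≤ x y≥0)

  -- This is (1 + y)^(n + 1) ≥ 1 + (n + 1) y for y = (g - x)/x, cleared of denominators so that x =
  -- 0 is allowed. In the induction step the slack is a nonnegative multiple of (g - x)².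
  bernoulli : ∀ n {x g} → 0ℚ ≤ x → 0ℚ ≤ g → x ^ n * (x + ℕ→ℚ (suc n) * (g - x)) ≤ g ^ suc n
  bernoulli zero {x} {g} _ _ = ≤-reflexive
    (solve 2 (λ x g → con 1ℚ :* (x :+ con 1ℚ :* (g :- x)) := g :* con 1ℚ) refl x g)
  bernoulli (suc n) {x} {g} x≥0 g≥0 = begin
    x * x ^ n * (x + ℕ→ℚ (suc (suc n)) * (g - x))
      ≡⟨ cong (λ m → x * x ^ n * (x + m * (g - x))) (ℕ→ℚ-suc (suc n)) ⟩
    x * x ^ n * (x + (1ℚ + ℕ→ℚ (suc n)) * (g - x))
      ≤⟨ x≤x+y _ (*-nonneg (^-nonneg n x≥0) (*-nonneg (ℕ→ℚ-nonneg (suc n)) (square-nonneg (g - x)))) ⟩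
    x * x ^ n * (x + (1ℚ + ℕ→ℚ (suc n)) * (g - x)) + x ^ n * (ℕ→ℚ (suc n) * ((g - x) * (g - x)))
      ≡⟨ solve 4 (λ x g m p → x :* p :* (x :+ (con 1ℚ :+ m) :* (g :- x)) :+ p :* (m :* ((g :- x) :* (g :- x)))
           := g :* (p :* (x :+ m :* (g :- x)))) refl x g (ℕ→ℚ (suc n)) (x ^ n) ⟩
    g * (x ^ n * (x + ℕ→ℚ (suc n) * (g - x)))
      ≤⟨ *-monoʳ g≥0 (bernoulli n x≥0 g≥0) ⟩
    g * g ^ suc n ∎
    where open ≤-Reasoning

  sum-nonneg : ∀ {n} (a : Fin n → ℚ) → (∀ i → 0ℚ < a i) → 0ℚ ≤ sumℚ a
  sum-nonneg {zero}  a a>0 = ≤-refl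
  sum-nonneg {suc n} a a>0 = +-mono-≤ (<⇒≤ (a>0 zero)) (sum-nonneg (λ i → a (suc i)) (λ i → a>0 (suc i)))

  mean-nonneg : ∀ {n} (a : Fin (suc n) → ℚ) → (∀ i → 0ℚ < a i) → ∀ {g} → ℕ→ℚ (suc n) * g ≡ sumℚ a → 0ℚ ≤ g
  mean-nonneg {n} a a>0 {g} e = *-cancelˡ-≤-pos (ℕ→ℚ (suc n)) {{positive (ℕ→ℚ-pos n)}}
    (subst (_≤ ℕ→ℚ (suc n) * g) (sym (*-zeroʳ (ℕ→ℚ (suc n)))) (subst (0ℚ ≤_) (sym e) (sum-nonneg a a>0)))

  mean : ∀ n σ → ∃ λ g → ℕ→ℚ (suc n) * g ≡ σ
  mean n σ = from-inverse (inverse (ℕ→ℚ-pos n))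
    where
    from-inverse : (∃ λ r → 0ℚ < r × ℕ→ℚ (suc n) * r ≡ 1ℚ) → ∃ λ g → ℕ→ℚ (suc n) * g ≡ σ
    from-inverse (r , _ , e) = r * σ , trans (sym (*-assoc (ℕ→ℚ (suc n)) r σ)) (trans (cong (_* σ) e) (*-identityˡ σ))

  -- Bernoulli's inequality at the mean x of the tail: there x + (n + 2) (g - x) is the head.
  am-gm : ∀ n (a : Fin (suc n) → ℚ) → (∀ i → 0ℚ < a i) → ∀ {g} → ℕ→ℚ (suc n) * g ≡ sumℚ a → prodℚ a ≤ g ^ suc n
  am-gm zero    a a>0 {g} e = ≤-reflexive (trans (*-identityʳ (a zero))
    (trans (sym (+-identityʳ (a zero))) (trans (sym e) (*-comm 1ℚ g))))
  am-gm (suc n) a a>0 {g} e = from-mean (mean n (sumℚ t))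
    where
    open ≤-Reasoning
    t : Fin (suc n) → ℚ
    t i = a (suc i)
    t>0 : ∀ i → 0ℚ < t i
    t>0 i = a>0 (suc i)
    from-mean : (∃ λ x → ℕ→ℚ (suc n) * x ≡ sumℚ t) → prodℚ a ≤ g ^ suc (suc n)
    from-mean (x , ex) = begin
      a zero * prodℚ t
        ≤⟨ *-monoʳ (<⇒≤ (a>0 zero)) (am-gm n t t>0 ex) ⟩
      a zero * x ^ suc n
        ≡⟨ trans (*-comm (a zero) (x ^ suc n)) (cong (x ^ suc n *_) head≡) ⟩
      x ^ suc n * (x + ℕ→ℚ (suc (suc n)) * (g - x))
        ≤⟨ bernoulli (suc n) (mean-nonneg t t>0 ex) (mean-nonneg a a>0 e) ⟩
      g ^ suc (suc n) ∎
      where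
      head≡ : a zero ≡ x + ℕ→ℚ (suc (suc n)) * (g - x)
      head≡ = E.begin
        a zero                                                       E.≡⟨ solve 2 (λ h s → h := h :+ s :- s) refl (a zero) (sumℚ t) ⟩
        a zero + sumℚ t - sumℚ t                                     E.≡⟨ cong₂ _-_ (sym e) (sym ex) ⟩
        ℕ→ℚ (suc (suc n)) * g - ℕ→ℚ (suc n) * x                      E.≡⟨ cong (λ m → m * g - ℕ→ℚ (suc n) * x) (ℕ→ℚ-suc (suc n)) ⟩
        (1ℚ + ℕ→ℚ (suc n)) * g - ℕ→ℚ (suc n) * x                     E.≡⟨ solve 3 (λ m g x → (con 1ℚ :+ m) :* g :- m :* x := x :+ (con 1ℚ :+ m) :* (g :- x)) refl (ℕ→ℚ (suc n)) g x ⟩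
        x + (1ℚ + ℕ→ℚ (suc n)) * (g - x)                             E.≡⟨ cong (λ m → x + m * (g - x)) (ℕ→ℚ-suc (suc n)) ⟨
        x + ℕ→ℚ (suc (suc n)) * (g - x)                              E.∎
        where module E = ≡-Reasoning

  ^-≤1 : ∀ n {g} → 0ℚ ≤ g → g ≤ 1ℚ → g ^ n ≤ 1ℚ
  ^-≤1 zero    _   _   = ≤-refl
  ^-≤1 (suc n) {g} g≥0 g≤1 = ≤-trans (*-monoʳ g≥0 (^-≤1 n g≥0 g≤1)) (≤-trans (≤-reflexive (*-identityʳ g)) g≤1)

  ^-reflects-1≤ : ∀ n {g} → 0ℚ ≤ g → 1ℚ ≤ g ^ suc n → 1ℚ ≤ g
  ^-reflects-1≤ n {g} g≥0 h = ≮⇒≥ λ g<1 → <-irrefl refl (<-≤-trans (≤-<-trans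
    (≤-trans (*-monoʳ g≥0 (^-≤1 n g≥0 (<⇒≤ g<1))) (≤-reflexive (*-identityʳ g))) g<1) h)

  ℕ→ℚ-reflects-≤ : ∀ {m n} → ℕ→ℚ m ≤ ℕ→ℚ n → m ℕ.≤ n
  ℕ→ℚ-reflects-≤ {m} {n} h = ℕ.≮⇒≥ λ n<m → <-irrefl refl (≤-<-trans h (n<m⇒ n<m))
    where
    n<m⇒ : n ℕ.< m → ℕ→ℚ n < ℕ→ℚ m
    n<m⇒ n<m = subst₂ _<_ (+-identityʳ (ℕ→ℚ n)) (trans (sym (ℤ→ℚ-+ (+ n) (+ suc (m ℕ.∸ suc n)))) (cong ℕ→ℚ
        (trans (ℕ.+-suc n (m ℕ.∸ suc n)) (ℕ.m+[n∸m]≡n n<m))))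
      (+-monoʳ-< (ℕ→ℚ n) (ℕ→ℚ-pos (m ℕ.∸ suc n)))

  -- With product 1, a power of the mean g is at least 1, hence so is g, and s is the number of
  -- terms times g.
  InA⇒≤ : ∀ n {s} → InA n s → n ℕ.≤ s
  InA⇒≤ zero _ = ℕ.z≤n
  InA⇒≤ (suc n) {s} (a , a>0 , prod≡1 , sum≡s) = from-mean (mean n (sumℚ a))
    where
    from-mean : (∃ λ g → ℕ→ℚ (suc n) * g ≡ sumℚ a) → suc n ℕ.≤ s
    from-mean (g , e) = ℕ→ℚ-reflects-≤ (subst₂ _≤_ (*-identityʳ (ℕ→ℚ (suc n))) (trans e sum≡s)
      (*-monoʳ (ℕ→ℚ-nonneg (suc n)) (^-reflects-1≤ n (mean-nonneg a a>0 e) (subst (_≤ g ^ suc n) prod≡1 (am-gm n a a>0 e)))))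

open import Data.Nat using (_≤_)

theorem2p2 : (n : ℕ) → 9 ≤ n → (s : ℕ) → 1 ≤ s → (InA n s ⇔ n ≤ s)
theorem2p2 n 9≤n s _ = mk⇔ (RationalSums.InA⇒≤ n) (RationalSums.realised 9≤n)
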